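{- Let $P$ and $Q$ be nontrivial partially ordered generalized patterns such that $\mathrm{Av}(P)=\mathrm{Av}(Q)$. Then $Q$ can be obtained from $P$ by a succession of additions and removals of single dashes that preserves the set of avoiders at each step; that is, there is a finite sequence of patterns $P=P_0,P_1,\dots,P_r=Q$ such that, for each $i<r$, $P_{i+1}$ is obtained from $P_i$ by adding a single dash or by removing a single dash, and $\mathrm{Av}(P_i)=\mathrm{Av}(P_{i+1})$.
   Context: A permutation of length $n$ is a word containing each element of $\{1,\dots,n\}$ exactly once; $\mathcal{S}$ is the set of all permutations of all lengths $n\ge0$. A partially ordered generalized pattern $P$ is a nonempty word $p_1p_2\dots p_m$ of positive integers (repetitions allowed), whose set of letters is $\{1,2,\dots,r\}$ for some $r$, with a dash written between some of the consecutive letters. An occurrence of $P$ in a permutation $\pi=a_1\dots a_n$ is a subsequence $a_{k_1}\dots a_{k_m}$, $k_1<\dots<k_m$, such that (a) $p_i>p_j$ implies $a_{k_i}>a_{k_j}$ for all $i,j$ (no condition when $p_i=p_j$), and (b) $k_{i+1}=k_i+1$ whenever $p_i$ and $p_{i+1}$ are not separated by a dash. $\mathrm{Av}(P)$ is the set of permutations in $\mathcal{S}$ with no occurrence of $P$. A pattern is nontrivial if it does not consist only of the letter $1$. Adding (removing) a single dash means inserting (deleting) a dash between two consecutive letters that are not (are) currently separated by a dash. -}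

module Defs where

open import Data.Bool.Base using (Bool)
open import Data.Fin.Base using (Fin; suc; toℕ; inject₁; _<_)
open import Data.Fin.Permutation using (Permutation′; _⟨$⟩ʳ_)
open import Data.Fin.Subset using (Subset; inside; outside; _∈_; _∉_)
open import Data.Nat.Base as ℕ using (ℕ)
open import Data.Product.Base using (Σ; ∃; _×_; _,_)
open import Data.Sum.Base using (_⊎_)
open import Data.Vec.Base using (Vec; lookup; _[_]≔_)
open import Data.Vec.Membership.Propositional using () renaming (_∈_ to _∈ᵛ_)
open import Data.Vec.Relation.Unary.All using (All)
open import Level using (0ℓ)
open import Relation.Binary.Core using (Rel)
open import Relation.Binary.PropositionalEquality.Core using (_≡_)
open import Relation.Nullary.Negation.Core using (¬_)
open import Relation.Unary using (Pred; _≐_)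

-- The i-th letter of π is π ⟨$⟩ʳ i; positions and letters both count from 0.
𝒮 : Set
𝒮 = Σ ℕ Permutation′

-- The letters 1, …, r are represented by the elements 0, …, r-1 of Fin r.
-- Gap j lies between the letters at positions inject₁ j and suc j, and
-- dashes is the set of gaps that carry a dash.
-- The proof that every letter occurs is irrelevant, so two patterns with the
-- same word and the same dashes are propositionally equal.
record Pattern : Set where
  constructor mkPattern
  field
    r       : ℕ
    gaps    : ℕ
    word    : Vec (Fin r) (ℕ.suc gaps)
    dashes  : Subset gaps
    .onto   : ∀ a → a ∈ᵛ word

open Pattern public using (r; gaps; word; dashes)

Nontrivial : Pred Pattern 0ℓ
Nontrivial P = ¬ All (λ a → toℕ a ≡ 0) (word P)

record Occurrence (P : Pattern) {n : ℕ} (π : Permutation′ n) : Set where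
  field
    position   : Fin (ℕ.suc (gaps P)) → Fin n
    increasing : ∀ i j → i < j → position i < position j
    ordered    : ∀ i j → lookup (word P) j < lookup (word P) i →
                 π ⟨$⟩ʳ position j < π ⟨$⟩ʳ position i
    adjacent   : ∀ j → j ∉ dashes P →
                 toℕ (position (suc j)) ≡ ℕ.suc (toℕ (position (inject₁ j)))

Av : Pattern → Pred 𝒮 0ℓ
Av P (_ , π) = ¬ Occurrence P π

setGap : (P : Pattern) → Fin (gaps P) → Bool → Pattern
setGap (mkPattern r g w d o) j s = mkPattern r g w (d [ j ]≔ s) o

AddsDash : Rel Pattern 0ℓ
AddsDash P Q = ∃ λ j → j ∉ dashes P × Q ≡ setGap P j inside

RemovesDash : Rel Pattern 0ℓ
RemovesDash P Q = ∃ λ j → j ∈ dashes P × Q ≡ setGap P j outside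

AvPreservingStep : Rel Pattern 0ℓ
AvPreservingStep P Q = (AddsDash P Q ⊎ RemovesDash P Q) × Av P ≐ Av Q

{-# OPTIONS --safe #-}

-- The words agree: the shortest permutations containing a pattern are the
-- linear extensions of the order of its letters, and these determine the word.
-- For the dashes, let gap j be closed in P but dashed in Q. Every linear
-- extension of the word with one or two values inserted at gap j contains Q,
-- hence P. Since gap j is closed in P, an inserted value must play letter j or
-- letter j + 1. Varying the inserted values shows that these two letters are
-- the least and the greatest one and leaves only a few shapes for the blocks
-- of letters joined on either side of gap j. In each of these shapes, an
-- occurrence of P with a dash added at j can be turned into an occurrence of P
-- by sliding the block inside the stretch it spans, so adding that dash
-- preserves the avoiders. Hence P and Q can both be moved to the union of
-- their sets of dashes.
module Submission where

open import Data.Bool.Base using (true; false; T)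
open import Data.Bool.Properties using () renaming (_≟_ to _≟ᵇ_)
open import Data.Empty using (⊥)
open import Data.Fin.Base as F using (Fin; toℕ; fromℕ<; inject₁; punchOut)
open import Data.Fin.Permutation using (Permutation′; permutation; _⟨$⟩ʳ_)
import Data.Fin.Properties as FP
open import Data.Fin.Subset using (Subset; inside; outside; _∈_; _∉_; _⊆_; _⊂_; ∣_∣)
import Data.Fin.Subset.Properties as SP
open import Data.List.Base using (List; []; _∷_; allFin)
open import Data.List.Membership.Propositional using () renaming (_∈_ to _∈ˡ_)
open import Data.List.Membership.Propositional.Properties using (∈-allFin)
open import Data.List.Relation.Unary.Any using (here; there)
open import Data.Nat.Base
open import Data.Nat.Properties
open import Data.Product.Base using (∃; _×_; _,_; proj₁; proj₂; swap)
open import Data.Sum.Base using (_⊎_; inj₁; inj₂; [_,_]′)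
open import Data.Unit.Base using (tt)
open import Data.Vec.Base as V using (Vec; []; _∷_; lookup; tabulate; _[_]≔_)
import Data.Vec.Properties as VP
open import Data.Vec.Relation.Unary.All.Properties using (lookup⁻)
import Data.Vec.Relation.Unary.Any as Any
import Data.Vec.Relation.Unary.Any.Properties as Any
open import Defs
open import Function.Base using (_∘_; id; case_of_; flip)
open import Function.Bundles using (Injection)
open import Function.Properties.Inverse using (↔⇒↣)
open import Level using (0ℓ)
open import Relation.Binary.Construct.Closure.ReflexiveTransitive using (Star; ε; _◅_; _◅◅_; reverse)
open import Relation.Binary.Core using (Rel)
open import Relation.Binary.Definitions using (tri<; tri≈; tri>; Total; Transitive)
open import Relation.Binary.PropositionalEquality
open import Relation.Nullary using (¬_; Dec; yes; no)
open import Relation.Nullary.Decidable using (dec-true; decidable-stable; recompute; _×-dec_)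
open import Relation.Nullary.Negation using (contradiction)
open import Relation.Unary using (Decidable; _≐_) renaming (_⊆_ to _⊆ᵖ_)

-- Permutations as injective sequences

-- For a gap `j`, the hypothesis on `Q` is used in the form `Forces m p (_≢ j) C`: every sequence
-- containing the word with all gaps but `j` closed contains `P`. The analysis of the gap thus
-- concerns `P` and `j` alone, and as the added dash keeps the avoiders, it can be repeated at the
-- next gap. The obstacle is that bringing letters `j` and `j + 1` together drags along all letters
-- joined to them, which then take new and uncontrolled values. The inserted values serve to exclude
-- exactly those words in which this could break the order. Avoidance is a negation, so containment
-- is only obtained up to double negation. This suffices, because every conclusion drawn from it is
-- decidable, a contradiction, or doubly negated again.

Injective< : ℕ → (ℕ → ℕ) → Set
Injective< n v = ∀ {a b} → a < n → b < n → v a ≡ v b → a ≡ b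

-- Pigeonhole: a value `y` outside the image could be punched out of the codomain, leaving an
-- injection of `Fin (suc n)` into `Fin n`.
injective⇒surjective : ∀ {n} (f : Fin n → Fin n) → (∀ {i j} → f i ≡ f j → i ≡ j) →
  ∀ y → ∃ λ x → f x ≡ y
injective⇒surjective {zero}  f inj ()
injective⇒surjective {suc n} f inj y with FP.any? (λ x → f x FP.≟ y)
... | yes hit  = hit
... | no  miss = contradiction
  (λ {i} {j} eq → inj (FP.punchOut-injective (miss′ i) (miss′ j) eq))
  (FP.<⇒notInjective {f = λ x → punchOut (miss′ x)} (n<1+n n))
  where
  miss′ : ∀ x → y ≢ f x
  miss′ x y≡fx = miss (x , sym y≡fx)

module Standardization {n : ℕ} (f : Fin n → ℕ) (inj : ∀ {i j} → f i ≡ f j → i ≡ j) where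

  below : Fin n → Subset n
  below i = tabulate λ j → f j <ᵇ f i

  ∈-below⁺ : ∀ {i j} → f j < f i → j ∈ below i
  ∈-below⁺ {i} {j} lt = VP.lookup⇒[]= j _
    (trans (VP.lookup∘tabulate _ j) (dec-true (f j <? f i) lt))

  ∈-below⁻ : ∀ {i j} → j ∈ below i → f j < f i
  ∈-below⁻ {i} {j} mem = <ᵇ⇒< _ _
    (subst T (trans (sym (VP.[]=⇒lookup mem)) (VP.lookup∘tabulate _ j)) tt)

  below-⊂ : ∀ {i j} → f i < f j → below i ⊂ below j
  below-⊂ {i} lt =
    (λ mem → ∈-below⁺ (<-trans (∈-below⁻ mem) lt)) , i , ∈-below⁺ lt , λ mem → <-irrefl refl (∈-below⁻ mem)

  below-small : ∀ i → ∣ below i ∣ < n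
  below-small i = subst (∣ below i ∣ <_) (SP.∣⊤∣≡n n)
    (SP.p⊂q⇒∣p∣<∣q∣ (SP.⊆-max _ , i , SP.∈⊤ , λ mem → <-irrefl refl (∈-below⁻ mem)))

  -- Strict inclusion between the sets `below` makes the number of smaller values strictly monotone
  -- in the value, so the ranks form a permutation in the same relative order.
  rank : Fin n → Fin n
  rank i = fromℕ< (below-small i)

  rank-mono : ∀ {i j} → f i < f j → rank i F.< rank j
  rank-mono lt = subst₂ _<_ (sym (FP.toℕ-fromℕ< _)) (sym (FP.toℕ-fromℕ< _)) (SP.p⊂q⇒∣p∣<∣q∣ (below-⊂ lt))

  rank-injective : ∀ {i j} → rank i ≡ rank j → i ≡ j
  rank-injective {i} {j} eq with <-cmp (f i) (f j)
  ... | tri< lt _ _ = contradiction eq (FP.<⇒≢ (rank-mono lt))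
  ... | tri≈ _ e  _ = inj e
  ... | tri> _ _ gt = contradiction (sym eq) (FP.<⇒≢ (rank-mono gt))

  standardization : Permutation′ n
  standardization = permutation rank (proj₁ ∘ onto) (proj₂ ∘ onto)
    (λ x → rank-injective (proj₂ (onto (rank x))))
    where onto = injective⇒surjective rank rank-injective

-- Occurrences with natural-number indices

nth : ∀ {a} {A : Set a} {n} → A → Vec A n → ℕ → A
nth d []       _       = d
nth d (x ∷ xs) zero    = x
nth d (x ∷ xs) (suc i) = nth d xs i

nth-lookup : ∀ {a} {A : Set a} {n} (d : A) (xs : Vec A n) i → nth d xs (toℕ i) ≡ lookup xs i
nth-lookup d (x ∷ xs) F.zero    = refl
nth-lookup d (x ∷ xs) (F.suc i) = nth-lookup d xs i

nth-map : ∀ {a b} {A : Set a} {B : Set b} {n} (d : B) (f : A → B) (xs : Vec A n) i →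
  nth d (V.map f xs) (toℕ i) ≡ f (lookup xs i)
nth-map d f xs i = trans (nth-lookup d (V.map f xs) i) (VP.lookup-map i f xs)

nth-tabulate : ∀ {a} {A : Set a} {n} (d : A) (f : Fin n → A) i → nth d (tabulate f) (toℕ i) ≡ f i
nth-tabulate d f i = trans (nth-lookup d (tabulate f) i) (VP.lookup∘tabulate f i)

∀<-intro : ∀ {ℓ} {n} (T : ℕ → Set ℓ) → (∀ (i : Fin n) → T (toℕ i)) → ∀ {i} → i < n → T i
∀<-intro T h i<n = subst T (FP.toℕ-fromℕ< i<n) (h (fromℕ< i<n))

∀<-intro₂ : ∀ {ℓ} {m n} (T : ℕ → ℕ → Set ℓ) → (∀ (i : Fin m) (j : Fin n) → T (toℕ i) (toℕ j)) →
  ∀ {i j} → i < m → j < n → T i j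
∀<-intro₂ T h {j = j} i<m j<n = ∀<-intro (λ i → T i j) (λ i → ∀<-intro (T (toℕ i)) (h i) j<n) i<m

-- Occurrences with positions, letters and gaps indexed by ℕ: p is a word of
-- length m, C i says that letters i and i + 1 are not separated by a dash,
-- and v lists the n values of a sequence.
record Occ (m : ℕ) (p : ℕ → ℕ) (C : ℕ → Set) (n : ℕ) (v : ℕ → ℕ) : Set where
  field
    k     : ℕ → ℕ
    bound : ∀ {i} → i < m → k i < n
    incr  : ∀ {i} → suc i < m → k i < k (suc i)
    adj   : ∀ {i} → suc i < m → C i → k (suc i) ≡ suc (k i)
    ord   : ∀ {i j} → i < m → j < m → p i < p j → v (k i) < v (k j)

open Occ

incr⇒mono : ∀ {m} (k : ℕ → ℕ) → (∀ {i} → suc i < m → k i < k (suc i)) →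
  ∀ {i j} → i < j → j < m → k i < k j
incr⇒mono k inc {i} {suc j} i<1+j 1+j<m with m<1+n⇒m<n∨m≡n i<1+j
... | inj₁ i<j  = <-trans (incr⇒mono k inc i<j (<⇒≤ 1+j<m)) (inc 1+j<m)
... | inj₂ refl = inc 1+j<m

wordℕ : Pattern → ℕ → ℕ
wordℕ P = nth 0 (V.map toℕ (word P))

-- The default value makes every gap past the end closed. For this reason the maximality of a block
-- on the right is only demanded when the block ends before the last letter.
Closed : Pattern → ℕ → Set
Closed P i = nth outside (dashes P) i ≡ outside

values : ∀ {n} → Permutation′ n → ℕ → ℕ
values π = nth 0 (tabulate λ i → toℕ (π ⟨$⟩ʳ i))

values-toℕ : ∀ {n} (π : Permutation′ n) i → values π (toℕ i) ≡ toℕ (π ⟨$⟩ʳ i)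
values-toℕ π = nth-tabulate 0 _

length : Pattern → ℕ
length P = suc (gaps P)

OccP : Pattern → (n : ℕ) → (ℕ → ℕ) → Set
OccP P = Occ (length P) (wordℕ P) (Closed P)

∉⇒lookup : ∀ {n} (s : Subset n) {j} → j ∉ s → lookup s j ≡ outside
∉⇒lookup s {j} j∉s with lookup s j in eq
... | true  = contradiction (VP.lookup⇒[]= j s eq) j∉s
... | false = refl

∉⇒closed : ∀ P {j} → j ∉ dashes P → Closed P (toℕ j)
∉⇒closed P {j} j∉ = trans (nth-lookup _ (dashes P) j) (∉⇒lookup (dashes P) j∉)

closed⇒∉ : ∀ P {j} → Closed P (toℕ j) → j ∉ dashes P
closed⇒∉ P {j} cl mem with () ← trans (sym (trans (sym (nth-lookup _ (dashes P) j)) cl)) (VP.[]=⇒lookup mem)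

occurrence⇒Occ : ∀ P {n} {π : Permutation′ n} → Occurrence P π → OccP P n (values π)
occurrence⇒Occ P {n} {π} o = record
  { k     = κ
  ; bound = ∀<-intro (λ i → κ i < n) λ i → subst (_< n) (sym (κ≡ i)) (FP.toℕ<n _)
  ; incr  = λ { (s≤s i<g) → ∀<-intro (λ i → κ i < κ (suc i))
      (λ j → subst₂ _<_ (sym (κ-inject₁ j)) (sym (κ≡ (F.suc j)))
        (increasing (inject₁ j) (F.suc j) (s≤s (≤-reflexive (FP.toℕ-inject₁ j))))) i<g }
  ; adj   = λ { (s≤s i<g) → ∀<-intro (λ i → Closed P i → κ (suc i) ≡ suc (κ i))
      (λ j cl → trans (κ≡ (F.suc j)) (trans (adjacent j (closed⇒∉ P cl)) (cong suc (sym (κ-inject₁ j))))) i<g }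
  ; ord   = ∀<-intro₂ (λ i j → wordℕ P i < wordℕ P j → values π (κ i) < values π (κ j))
      λ i j lt → subst₂ _<_ (sym (values-κ i)) (sym (values-κ j))
         (ordered j i (subst₂ _<_ (nth-map 0 toℕ (word P) i) (nth-map 0 toℕ (word P) j) lt))
  }
  where
  open Occurrence o
  κ : ℕ → ℕ
  κ = nth 0 (tabulate (toℕ ∘ position))
  κ≡ : ∀ i → κ (toℕ i) ≡ toℕ (position i)
  κ≡ = nth-tabulate 0 _
  κ-inject₁ : ∀ j → κ (toℕ j) ≡ toℕ (position (inject₁ j))
  κ-inject₁ j = trans (cong κ (sym (FP.toℕ-inject₁ j))) (κ≡ (inject₁ j))
  values-κ : ∀ i → values π (κ (toℕ i)) ≡ toℕ (π ⟨$⟩ʳ position i)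
  values-κ i = trans (cong (values π) (κ≡ i)) (values-toℕ π (position i))

Occ⇒occurrence : ∀ P {n} {π : Permutation′ n} → OccP P n (values π) → Occurrence P π
Occ⇒occurrence P {n} {π} o = record
  { position   = pos
  ; increasing = λ i j i<j → subst₂ _<_ (sym (pos≡ i)) (sym (pos≡ j)) (incr⇒mono (k o) (incr o) i<j (FP.toℕ<n j))
  ; ordered    = λ i j lt → subst₂ _<_ (values-pos j) (values-pos i)
      (ord o (FP.toℕ<n j) (FP.toℕ<n i) (subst₂ _<_ (sym (nth-map 0 toℕ (word P) j)) (sym (nth-map 0 toℕ (word P) i)) lt))
  ; adjacent   = λ j j∉ → trans (pos≡ (F.suc j)) (trans (adj o (s≤s (FP.toℕ<n j)) (∉⇒closed P j∉))
      (cong suc (sym (trans (pos≡ (inject₁ j)) (cong (k o) (FP.toℕ-inject₁ j))))))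
  }
  where
  pos : Fin (length P) → Fin n
  pos i = fromℕ< (bound o (FP.toℕ<n i))
  pos≡ : ∀ i → toℕ (pos i) ≡ k o (toℕ i)
  pos≡ i = FP.toℕ-fromℕ< _
  values-pos : ∀ i → values π (k o (toℕ i)) ≡ toℕ (π ⟨$⟩ʳ pos i)
  values-pos i = trans (cong (values π) (sym (pos≡ i))) (values-toℕ π (pos i))

recolour : ∀ {m p p′ C n v v′} (o : Occ m p C n v) →
  (∀ {i j} → i < m → j < m → p′ i < p′ j → v′ (k o i) < v′ (k o j)) → Occ m p′ C n v′
recolour o h = record { k = k o ; bound = bound o ; incr = incr o ; adj = adj o ; ord = h }

weaken : ∀ {m p C C′ n v} → (∀ {i} → suc i < m → C′ i → C i) → Occ m p C n v → Occ m p C′ n v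
weaken h o = record { k = k o ; bound = bound o ; incr = incr o ; adj = λ lt c → adj o lt (h lt c) ; ord = ord o }

values-injective : ∀ {n} (π : Permutation′ n) → Injective< n (values π)
values-injective π = ∀<-intro₂ (λ a b → values π a ≡ values π b → a ≡ b)
  λ i j eq → cong toℕ (Injection.injective (↔⇒↣ π)
    (FP.toℕ-injective (trans (sym (values-toℕ π i)) (trans eq (values-toℕ π j)))))

module _ {n : ℕ} (v : ℕ → ℕ) (inj : Injective< n v) where
  open Standardization {n} (v ∘ toℕ) (λ {i} {j} eq → FP.toℕ-injective (inj (FP.toℕ<n i) (FP.toℕ<n j) eq))

  private
    π = standardization

    π-mono : ∀ {a b} → a < n → b < n → v a < v b → values π a < values π b
    π-mono = ∀<-intro₂ (λ a b → v a < v b → values π a < values π b)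
      λ i j lt → subst₂ _<_ (sym (values-toℕ π i)) (sym (values-toℕ π j)) (rank-mono lt)

    π-cancel : ∀ {a b} → a < n → b < n → values π a < values π b → v a < v b
    π-cancel {a} {b} a<n b<n lt with <-cmp (v a) (v b)
    ... | tri< lt′ _ _ = lt′
    ... | tri≈ _ eq _ = contradiction lt (<-irrefl (cong (values π) (inj a<n b<n eq)))
    ... | tri> _ _ gt = contradiction lt (<-asym (π-mono b<n a<n gt))

  -- Avoidance speaks of permutations only. Standardization keeps the relative order, so occurrences
  -- transfer between `v` and `π`; the result is doubly negated because `Av` is a negation.
  forced-occurrence : ∀ P Q → (∀ x → Av Q x → Av P x) → OccP P n v → ¬ ¬ OccP Q n v
  forced-occurrence P Q sub o none = sub (n , π) (λ q → none (recolour (occurrence⇒Occ Q q)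
        λ i<m j<m lt → let o′ = occurrence⇒Occ Q q in π-cancel (bound o′ i<m) (bound o′ j<m) (ord o′ i<m j<m lt)))
     (Occ⇒occurrence P (recolour o λ i<m j<m lt → π-mono (bound o i<m) (bound o j<m) (ord o i<m j<m lt)))

-- Spacing of the positions of an occurrence

i≤k : ∀ {m p C n v} (o : Occ m p C n v) → ∀ {i} → i < m → i ≤ k o i
i≤k o {zero}  _   = z≤n
i≤k o {suc i} lt = ≤-<-trans (i≤k o (<⇒≤ lt)) (incr o lt)

-- The displacement `k i - i` never decreases. Sums replace the difference to avoid truncated
-- subtraction; `rigid` is the case of equality along closed gaps.
spread : ∀ {m p C n v} (o : Occ m p C n v) → ∀ {i j} → i ≤ j → j < m → k o i + j ≤ k o j + i
spread o {i} {j} i≤j j<m with m≤n⇒m<n∨m≡n i≤j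
spread o {i} {suc j} i≤j j<m | inj₁ (s≤s i≤j′) = begin
  k o i + suc j     ≡⟨ +-suc (k o i) j ⟩
  suc (k o i + j)   ≤⟨ s≤s (spread o i≤j′ (<⇒≤ j<m)) ⟩
  suc (k o j) + i   ≤⟨ +-monoˡ-≤ i (incr o j<m) ⟩
  k o (suc j) + i   ∎
  where open ≤-Reasoning
spread o i≤j j<m | inj₂ refl = ≤-refl

rigid : ∀ {m p C n v} (o : Occ m p C n v) → ∀ {a b} → a ≤ b → b < m →
  (∀ {i} → a ≤ i → i < b → C i) → k o b + a ≡ k o a + b
rigid o {a} {b} a≤b b<m cl with m≤n⇒m<n∨m≡n a≤b
rigid o {a} {suc b} a≤b b<m cl | inj₁ (s≤s a≤b′) = begin
  k o (suc b) + a   ≡⟨ cong (_+ a) (adj o b<m (cl a≤b′ ≤-refl)) ⟩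
  suc (k o b + a)   ≡⟨ cong suc (rigid o a≤b′ (<⇒≤ b<m) (λ a≤i i<b → cl a≤i (m<n⇒m<1+n i<b))) ⟩
  suc (k o a + b)   ≡⟨ +-suc (k o a) b ⟨
  k o a + suc b     ∎
  where open ≡-Reasoning
rigid o a≤b b<m cl | inj₂ refl = refl

-- The letters after `i` need room for themselves. Together with `i≤k` this confines every
-- displacement to `0 … N`.
k≤ : ∀ N {m p C v} (o : Occ m p C (N + m) v) → ∀ {i} → i < m → k o i ≤ N + i
k≤ N {suc m} o {i} (s≤s i≤m) = +-cancelʳ-≤ m (k o i) (N + i) (begin
  k o i + m    ≤⟨ spread o i≤m ≤-refl ⟩
  k o m + i    ≤⟨ +-monoˡ-≤ i (s≤s⁻¹ (subst (suc (k o m) ≤_) (+-suc N m) (bound o ≤-refl))) ⟩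
  N + m + i    ≡⟨ +-assoc N m i ⟩
  N + (m + i)  ≡⟨ cong (N +_) (+-comm m i) ⟩
  N + (i + m)  ≡⟨ +-assoc N i m ⟨
  N + i + m    ∎)
  where open ≤-Reasoning

-- Insertion of one value into a sequence

insertAt : ℕ → ℕ → (ℕ → ℕ) → ℕ → ℕ
insertAt zero    e f zero    = e
insertAt zero    e f (suc a) = f a
insertAt (suc s) e f zero    = f zero
insertAt (suc s) e f (suc a) = insertAt s e (f ∘ suc) a

insertAt-at : ∀ s e f → insertAt s e f s ≡ e
insertAt-at zero    e f = refl
insertAt-at (suc s) e f = insertAt-at s e (f ∘ suc)

insertAt-< : ∀ s e f {a} → a < s → insertAt s e f a ≡ f a
insertAt-< (suc s) e f {zero}  _         = refl
insertAt-< (suc s) e f {suc a} (s≤s a<s) = insertAt-< s e (f ∘ suc) a<s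

insertAt-≥ : ∀ s e f {a} → s ≤ a → insertAt s e f (suc a) ≡ f a
insertAt-≥ zero    e f _                 = refl
insertAt-≥ (suc s) e f {suc a} (s≤s s≤a) = insertAt-≥ s e (f ∘ suc) s≤a

data InsertView (s : ℕ) : ℕ → Set where
  at    : InsertView s s
  left  : ∀ {a} → a < s → InsertView s a
  right : ∀ {a} → s ≤ a → InsertView s (suc a)

insertView : ∀ s a → InsertView s a
insertView s a with <-cmp a s
... | tri< a<s _ _ = left a<s
... | tri≈ _ refl _ = at
insertView s (suc a) | tri> _ _ (s≤s s≤a) = right s≤a

insertAt-injective : ∀ {n} s e f → s ≤ n → Injective< n f → (∀ {a} → a < n → f a ≢ e) →
  Injective< (suc n) (insertAt s e f)
insertAt-injective {n} s e f s≤n inj fresh {a} {b} a≤n b≤n eq with insertView s a | insertView s b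
... | at | at = refl
... | at | left b<s = contradiction (trans (sym (insertAt-< s e f b<s)) (trans (sym eq) (insertAt-at s e f)))
                                    (fresh (<-≤-trans b<s s≤n))
... | at | right s≤b = contradiction (trans (sym (insertAt-≥ s e f s≤b)) (trans (sym eq) (insertAt-at s e f)))
                                     (fresh (s≤s⁻¹ b≤n))
... | left a<s | at = contradiction (trans (sym (insertAt-< s e f a<s)) (trans eq (insertAt-at s e f)))
                                    (fresh (<-≤-trans a<s s≤n))
... | right s≤a | at = contradiction (trans (sym (insertAt-≥ s e f s≤a)) (trans eq (insertAt-at s e f)))
                                     (fresh (s≤s⁻¹ a≤n))
... | left a<s | left b<s = inj (<-≤-trans a<s s≤n) (<-≤-trans b<s s≤n)
      (trans (sym (insertAt-< s e f a<s)) (trans eq (insertAt-< s e f b<s)))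
... | right s≤a | right s≤b = cong suc (inj (s≤s⁻¹ a≤n) (s≤s⁻¹ b≤n)
      (trans (sym (insertAt-≥ s e f s≤a)) (trans eq (insertAt-≥ s e f s≤b))))
... | left a<s | right s≤b = contradiction
      (inj (<-≤-trans a<s s≤n) (s≤s⁻¹ b≤n) (trans (sym (insertAt-< s e f a<s)) (trans eq (insertAt-≥ s e f s≤b))))
      (<⇒≢ (<-≤-trans a<s s≤b))
... | right s≤a | left b<s = contradiction
      (inj (<-≤-trans b<s s≤n) (s≤s⁻¹ a≤n) (trans (sym (insertAt-< s e f b<s)) (trans (sym eq) (insertAt-≥ s e f s≤a))))
      (<⇒≢ (<-≤-trans b<s s≤a))

-- Linear extensions of the order of the letters

Forces : ℕ → (ℕ → ℕ) → (C C′ : ℕ → Set) → Set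
Forces m p C C′ = ∀ {n v} → Injective< n v → Occ m p C n v → ¬ ¬ Occ m p C′ n v

record Keys (m : ℕ) (p κ : ℕ → ℕ) : Set where
  field
    injective : Injective< m κ
    monotone  : ∀ {i j} → i < m → j < m → p i < p j → κ i < κ j

module Lexicographic (m : ℕ) (p t : ℕ → ℕ) (t<m : ∀ {i} → i < m → t i < m) (t-inj : Injective< m t) where

  -- With base `m`, letter `c` occupies keys from `c * m` up to, but excluding, `suc c * m`. The
  -- multiples of `m` therefore cut the keys between consecutive letters, and `t` orders equal
  -- letters.
  key : ℕ → ℕ
  key i = p i * m + t i

  key< : ∀ {i c} → i < m → p i < c → key i < c * m
  key< {i} {c} i<m lt = begin-strict
    p i * m + t i  <⟨ +-monoʳ-< (p i * m) (t<m i<m) ⟩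
    p i * m + m    ≡⟨ +-comm (p i * m) m ⟩
    suc (p i) * m  ≤⟨ *-monoˡ-≤ m lt ⟩
    c * m          ∎
    where open ≤-Reasoning

  key≥ : ∀ {i c} → c ≤ p i → c * m ≤ key i
  key≥ {i} le = ≤-trans (*-monoˡ-≤ m le) (m≤m+n _ (t i))

  key-tie : ∀ {i j} → p i ≤ p j → t i < t j → key i < key j
  key-tie le lt = +-mono-≤-< (*-monoˡ-≤ m le) lt

  keys : Keys m p key
  keys = record
    { monotone  = mono
    ; injective = λ {i} {j} i<m j<m eq → case <-cmp (p i) (p j) of λ
        { (tri< lt _ _) → contradiction eq (<⇒≢ (mono i<m j<m lt))
        ; (tri≈ _ e _)  → t-inj i<m j<m (+-cancelˡ-≡ (p i * m) _ _ (trans eq (cong (λ c → c * m + t j) (sym e))))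
        ; (tri> _ _ gt) → contradiction (sym eq) (<⇒≢ (mono j<m i<m gt))
        }
    }
    where
    mono : ∀ {i j} → i < m → j < m → p i < p j → key i < key j
    mono i<m j<m lt = <-≤-trans (key< i<m lt) (key≥ ≤-refl)

-- Equal letters ascend or descend from left to right; the choice is made so as to contradict an
-- assumed occurrence.
module Ascending (m : ℕ) (p : ℕ → ℕ) = Lexicographic m p id id (λ _ _ eq → eq)
module Descending (m : ℕ) (p : ℕ → ℕ) = Lexicographic m p (λ i → m ∸ suc i)
  (λ {i} i<m → subst (_≤ m) (+-∸-assoc 1 i<m) (m∸n≤m m i)) (λ a<m b<m eq → suc-injective (∸-cancelˡ-≡ a<m b<m eq))

odd-<-even⁻ : ∀ {a b} → suc (2 * a) < 2 * b → a < b
odd-<-even⁻ lt = *-cancelˡ-< 2 _ _ (<-trans (n<1+n _) lt)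

even-<-odd⁻ : ∀ {a b} → 2 * a < suc (2 * b) → a ≤ b
even-<-odd⁻ lt = *-cancelˡ-≤ 2 (s≤s⁻¹ lt)

odd-<-odd⁻ : ∀ {a b} → suc (2 * a) < suc (2 * b) → a < b
odd-<-odd⁻ lt = *-cancelˡ-< 2 _ _ (s≤s⁻¹ lt)

odd-<-even⁺ : ∀ {a b} → a < b → suc (2 * a) < 2 * b
odd-<-even⁺ {a} {b} lt = subst (_≤ 2 * b) (*-suc 2 a) (*-monoʳ-≤ 2 lt)

odd-<-odd⁺ : ∀ {a b} → a < b → suc (2 * a) < suc (2 * b)
odd-<-odd⁺ lt = s≤s (*-monoʳ-< 2 lt)

-- Linear extensions with values inserted at a gap

-- The letters of a linear extension get odd values and inserted values are
-- even, so 2 * E exceeds exactly the letters i with κ i < E.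
odd : (ℕ → ℕ) → ℕ → ℕ
odd κ i = suc (2 * κ i)

module Insertion {m : ℕ} {p : ℕ → ℕ} {C : ℕ → Set} {j : ℕ} (j+1<m : suc j < m) (Cj : C j)
                 (force : Forces m p (_≢ j) C) where

  private
    j<m : j < m
    j<m = <⇒≤ j+1<m

  shift : ℕ → ℕ → ℕ
  shift N i with i ≤? j
  ... | yes _ = i
  ... | no  _ = N + i

  shift-≤ : ∀ N {i} → i ≤ j → shift N i ≡ i
  shift-≤ N {i} i≤j with i ≤? j
  ... | yes _ = refl
  ... | no ¬l = contradiction i≤j ¬l

  shift-> : ∀ N {i} → j < i → shift N i ≡ N + i
  shift-> N {i} j<i with i ≤? j
  ... | yes l = contradiction l (<⇒≱ j<i)
  ... | no _  = refl

  -- The extension jumps over the `N` inserted values between letters `j` and `j + 1`, so all other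
  -- gaps may be closed.
  gapOccurrence : ∀ N v {κ} → Keys m p κ →
    (∀ {i} → i ≤ j → v i ≡ odd κ i) → (∀ {i} → j < i → v (N + i) ≡ odd κ i) →
    Occ m p (_≢ j) (N + m) v
  gapOccurrence N v {κ} K v-left v-right = record
    { k     = shift N
    ; bound = λ i<m → <-≤-trans (s≤s (shift-bound _)) (subst (_≤ N + m) (+-suc N _) (+-monoʳ-≤ N i<m))
    ; incr  = λ _ → incr-shift _
    ; adj   = λ _ → adj-shift _
    ; ord   = λ {i} {i′} i<m i′<m lt → subst₂ _<_ (sym (v-shift i)) (sym (v-shift i′))
                (odd-<-odd⁺ (Keys.monotone K i<m i′<m lt))
    }
    where
    shift-bound : ∀ i → shift N i ≤ N + i
    shift-bound i with i ≤? j
    ... | yes _ = m≤n+m i N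
    ... | no  _ = ≤-refl
    adj-shift : ∀ i → i ≢ j → shift N (suc i) ≡ suc (shift N i)
    adj-shift i i≢j with <-cmp i j
    ... | tri< i<j _ _ = trans (shift-≤ N i<j) (cong suc (sym (shift-≤ N (<⇒≤ i<j))))
    ... | tri≈ _ eq _  = contradiction eq i≢j
    ... | tri> _ _ i>j = trans (shift-> N (m<n⇒m<1+n i>j)) (trans (+-suc N i) (cong suc (sym (shift-> N i>j))))
    incr-shift : ∀ i → shift N i < shift N (suc i)
    incr-shift i with i ≟ j
    ... | no  i≢j  = ≤-reflexive (sym (adj-shift i i≢j))
    ... | yes refl = subst₂ _<_ (sym (shift-≤ N ≤-refl)) (sym (shift-> N ≤-refl)) (m≤n+m (suc i) N)
    v-shift : ∀ i → v (shift N i) ≡ odd κ i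
    v-shift i with i ≤? j
    ... | yes i≤j = v-left i≤j
    ... | no  i≰j = v-right (≰⇒> i≰j)

  odd-injective : ∀ {κ} → Keys m p κ → Injective< m (odd κ)
  odd-injective K a<m b<m eq = Keys.injective K a<m b<m (*-cancelˡ-≡ _ _ 2 (suc-injective eq))

  odd≢even : ∀ κ i E → odd κ i ≢ 2 * E
  odd≢even κ i E eq = even≢odd E (κ i) (sym eq)

  module Single {κ : ℕ → ℕ} (K : Keys m p κ) (E : ℕ) where

    v : ℕ → ℕ
    v = insertAt (suc j) (2 * E) (odd κ)

    v-left : ∀ {i} → i ≤ j → v i ≡ odd κ i
    v-left i≤j = insertAt-< (suc j) (2 * E) (odd κ) (s≤s i≤j)

    v-right : ∀ {i} → j < i → v (suc i) ≡ odd κ i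
    v-right j<i = insertAt-≥ (suc j) (2 * E) (odd κ) j<i

    v-at : v (suc j) ≡ 2 * E
    v-at = insertAt-at (suc j) (2 * E) (odd κ)

    single : ¬ ¬ Occ m p C (suc m) v
    single = force (insertAt-injective (suc j) _ _ (<⇒≤ j+1<m) (odd-injective K) (λ {a} _ → odd≢even κ a E))
                   (gapOccurrence 1 v K v-left v-right)

    module _ (o : Occ m p C (suc m) v) where

      -- Since gap j is closed, the inserted value plays letter j or letter j + 1.
      role : k o (suc j) ≡ suc j ⊎ k o j ≡ suc j
      role with m≤n⇒m<n∨m≡n (i≤k o j<m)
      ... | inj₁ j<k = inj₂ (≤-antisym (k≤ 1 o j<m) j<k)
      ... | inj₂ eq  = inj₁ (trans (adj o j+1<m Cj) (cong suc (sym eq)))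

      -- The letters left of the gap have no room to move: `i≤k` bounds their positions from below
      -- and `spread` up to `suc j` from above.
      k-left : k o (suc j) ≡ suc j → ∀ {i} → i ≤ suc j → k o i ≡ i
      k-left eq {i} i≤1+j = ≤-antisym
        (+-cancelʳ-≤ (suc j) _ _ (≤-trans (spread o i≤1+j j+1<m)
          (≤-reflexive (trans (cong (_+ i) eq) (+-comm (suc j) i)))))
        (i≤k o (≤-<-trans i≤1+j j+1<m))

      k-right : k o j ≡ suc j → ∀ {i} → j ≤ i → i < m → k o i ≡ suc i
      k-right eq {i} j≤i i<m = ≤-antisym (k≤ 1 o i<m)
        (+-cancelʳ-≤ j _ _ (≤-trans (≤-reflexive (trans (cong suc (+-comm i j)) (cong (_+ i) (sym eq))))
          (spread o j≤i i<m)))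

      v≤top : (∀ {i} → i < m → κ i < E) → ∀ {a} → a < suc m → v a ≤ 2 * E
      v≤top top {a} a≤m with insertView (suc j) a
      ... | at        = ≤-reflexive v-at
      ... | left a≤j  = subst (_≤ 2 * E) (sym (v-left (s≤s⁻¹ a≤j))) (<⇒≤ (odd-<-even⁺ (top (<-trans a≤j j+1<m))))
      ... | right j<a = subst (_≤ 2 * E) (sym (v-right j<a)) (<⇒≤ (odd-<-even⁺ (top (s≤s⁻¹ a≤m))))

      top-role : (∀ {i} → i < m → κ i < E) → ∀ {i h} → i < m → h < m → k o i ≡ suc j → p h ≤ p i
      top-role top {i} {h} i<m h<m eq = ≮⇒≥ λ lt → <⇒≱ (ord o i<m h<m lt)
        (subst (v (k o h) ≤_) (sym (trans (cong v eq) v-at)) (v≤top top (bound o h<m)))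

      bottom-role : E ≡ 0 → ∀ {i h} → i < m → h < m → k o i ≡ suc j → p i ≤ p h
      bottom-role refl {i} {h} i<m h<m eq = ≮⇒≥ λ lt →
        contradiction (subst (v (k o h) <_) (trans (cong v eq) v-at) (ord o h<m i<m lt)) λ ()

      module PlaysRight (eq : k o (suc j) ≡ suc j) {hi : ℕ} (p≤hi : ∀ {i} → i < m → p i ≤ hi)
                        (p-right : p (suc j) ≡ hi) (E≤hi : ∀ {i} → i < m → p i ≡ hi → E ≤ κ i) where

        -- An unshifted letter `i + 1` right of the gap takes the value of letter `i`, which is
        -- unshifted unless it is left of the gap. Inductively `p i` is `hi`, so this value lies
        -- above the inserted one; as the latter plays a `hi`, letter `i + 1` cannot be smaller.
        unshifted⇒hi : ∀ {i} → suc j ≤ i → i < m → k o i ≡ i → p i ≡ hi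
        unshifted⇒hi {i} j<i i<m ki with m≤n⇒m<n∨m≡n j<i
        ... | inj₂ refl = p-right
        unshifted⇒hi {suc i} _ i<m ki | inj₁ (s≤s j<i) = ≤∧≮⇒≡ (p≤hi i<m) λ lt →
          <⇒≱ (odd-<-even⁻ (subst₂ _<_ (trans (cong v ki) (v-right j<i)) (trans (cong v eq) v-at)
                (ord o i<m j+1<m (<-≤-trans lt (≤-reflexive (sym p-right))))))
              (E≤hi (<⇒≤ i<m) (unshifted⇒hi j<i (<⇒≤ i<m)
                (≤-antisym (s≤s⁻¹ (subst (suc (k o i) ≤_) ki (incr o i<m))) (i≤k o (<⇒≤ i<m)))))

        -- A letter below `hi` is never unshifted right of the gap, so it plays itself, and it must
        -- lie below the inserted value, which plays a `hi`.
        nonhi<E : ∀ {i} → i < m → p i < hi → κ i < E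
        nonhi<E {i} i<m lt = odd-<-even⁻ (subst₂ _<_ v-k (trans (cong v eq) v-at)
            (ord o i<m j+1<m (<-≤-trans lt (≤-reflexive (sym p-right)))))
          where
          v-k : v (k o i) ≡ odd κ i
          v-k with i ≤? j
          ... | yes i≤j = trans (cong v (k-left eq (≤-trans i≤j (n≤1+n j)))) (v-left i≤j)
          ... | no  i≰j with m≤n⇒m<n∨m≡n (i≤k o i<m)
          ...   | inj₁ i<k = trans (cong v (≤-antisym (k≤ 1 o i<m) i<k)) (v-right (≰⇒> i≰j))
          ...   | inj₂ ki  = contradiction (unshifted⇒hi (≰⇒> i≰j) i<m (sym ki)) (<⇒≢ lt)

      module PlaysLeft (eq : k o j ≡ suc j) (p-left : p j ≡ 0)
                       (lo<E : ∀ {i} → i < m → p i ≡ 0 → κ i < E) where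

        -- Mirror image of `unshifted⇒hi`, by induction on the distance `d` to `j`: a shifted letter
        -- `i` left of `j` takes the value of letter `i + 1`, which lies below the inserted value
        -- playing a `0`.
        shifted⇒lo : ∀ d {i} → d + i ≡ j → k o i ≡ suc i → p i ≡ 0
        shifted⇒lo zero    refl ki = p-left
        shifted⇒lo (suc d) {i} d+i ki with p i in pi
        ... | zero   = refl
        ... | suc _  = contradiction (lo<E 1+i<m (shifted⇒lo d (trans (+-suc d i) d+i) k1+i)) (≤⇒≯
            (even-<-odd⁻ (subst₂ _<_ (trans (cong v eq) v-at) (trans (cong v ki) (v-left 1+i≤j))
              (ord o j<m (<⇒≤ 1+i<m) (subst₂ _<_ (sym p-left) (sym pi) z<s)))))
          where
          1+i≤j : suc i ≤ j
          1+i≤j = subst (suc i ≤_) d+i (s≤s (m≤n+m i d))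
          1+i<m : suc i < m
          1+i<m = ≤-<-trans 1+i≤j j<m
          k1+i : k o (suc i) ≡ suc (suc i)
          k1+i = ≤-antisym (k≤ 1 o 1+i<m) (subst (_< k o (suc i)) ki (incr o 1+i<m))

        E≤nonlo : ∀ {i} → i < m → 0 < p i → E ≤ κ i
        E≤nonlo {i} i<m lt = even-<-odd⁻ (subst₂ _<_ (trans (cong v eq) v-at) v-k
            (ord o j<m i<m (subst (_< p i) (sym p-left) lt)))
          where
          v-k : v (k o i) ≡ odd κ i
          v-k with i ≤? j
          ... | no  i≰j = trans (cong v (k-right eq (<⇒≤ (≰⇒> i≰j)) i<m)) (v-right (≰⇒> i≰j))
          ... | yes i≤j with m≤n⇒m<n∨m≡n (i≤k o i<m)
          ...   | inj₁ i<k = contradiction (shifted⇒lo (j ∸ i) (m∸n+n≡m i≤j) (≤-antisym (k≤ 1 o i<m) i<k)) (>⇒≢ lt)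
          ...   | inj₂ ki  = trans (cong v (sym ki)) (v-left i≤j)

  module Double {κ : ℕ → ℕ} (K : Keys m p κ) (E : ℕ) where

    w : ℕ → ℕ
    w = insertAt (suc j) 0 (odd κ)

    v : ℕ → ℕ
    -- Inserting at the same place again puts the top value directly before the bottom value `0`;
    -- `suc E` keeps the two distinct.
    v = insertAt (suc j) (2 * suc E) w

    v-left : ∀ {i} → i ≤ j → v i ≡ odd κ i
    v-left i≤j = trans (insertAt-< (suc j) _ w (s≤s i≤j)) (insertAt-< (suc j) _ (odd κ) (s≤s i≤j))

    v-right : ∀ {i} → j < i → v (suc (suc i)) ≡ odd κ i
    v-right j<i = trans (insertAt-≥ (suc j) _ w (m≤n⇒m≤1+n j<i)) (insertAt-≥ (suc j) _ (odd κ) j<i)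

    v-top : v (suc j) ≡ 2 * suc E
    v-top = insertAt-at (suc j) _ w

    v-bottom : v (suc (suc j)) ≡ 0
    v-bottom = trans (insertAt-≥ (suc j) _ w ≤-refl) (insertAt-at (suc j) _ (odd κ))

    w≢top : ∀ {a} → a < suc m → w a ≢ 2 * suc E
    w≢top {a} _ eq with insertView (suc j) a
    ... | at        = contradiction (trans (sym (insertAt-at (suc j) _ (odd κ))) eq) λ ()
    ... | left a≤j  = odd≢even κ a (suc E) (trans (sym (insertAt-< (suc j) _ (odd κ) a≤j)) eq)
    ... | right {b} j<b = odd≢even κ b (suc E) (trans (sym (insertAt-≥ (suc j) _ (odd κ) j<b)) eq)

    double : ¬ ¬ Occ m p C (suc (suc m)) v
    double = force (insertAt-injective (suc j) _ w (<⇒≤ (m<n⇒m<1+n j+1<m))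
                      (insertAt-injective (suc j) 0 _ (<⇒≤ j+1<m) (odd-injective K) (λ _ → λ ())) w≢top)
                   (gapOccurrence 2 v K v-left v-right)

    module _ (top : ∀ {i} → i < m → κ i < suc E) (o : Occ m p C (suc (suc m)) v) where

      v≤top : ∀ {a} → a < suc (suc m) → v a ≤ 2 * suc E
      v≤top {a} a<2+m with insertView (suc j) a
      ... | at = ≤-reflexive v-top
      ... | left a≤j = subst (_≤ 2 * suc E) (sym (v-left (s≤s⁻¹ a≤j))) (<⇒≤ (odd-<-even⁺ (top (<-trans a≤j j+1<m))))
      ... | right {b} j<b with insertView (suc j) b
      ...   | at         = subst (_≤ 2 * suc E) (sym v-bottom) z≤n
      ...   | left b<1+j = contradiction j<b (<⇒≱ b<1+j)
      ...   | right j<c  = subst (_≤ 2 * suc E) (sym (v-right j<c)) (<⇒≤ (odd-<-even⁺ (top (s≤s⁻¹ (s≤s⁻¹ a<2+m)))))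

      top-role : ∀ {i h} → i < m → h < m → k o i ≡ suc j → p h ≤ p i
      top-role {i} {h} i<m h<m eq = ≮⇒≥ λ lt → <⇒≱ (ord o i<m h<m lt)
        (subst (v (k o h) ≤_) (sym (trans (cong v eq) v-top)) (v≤top (bound o h<m)))

      bottom-role : ∀ {i h} → i < m → h < m → k o i ≡ suc (suc j) → p i ≤ p h
      bottom-role {i} {h} i<m h<m eq = ≮⇒≥ λ lt →
        contradiction (subst (v (k o h) <_) (trans (cong v eq) v-bottom) (ord o h<m i<m lt)) λ ()

-- Shapes of the blocks around a removable dash

record LeftBlock (C : ℕ → Set) (j : ℕ) : Set where
  field
    x      : ℕ
    x≤j    : x ≤ j
    closed : ∀ {i} → x ≤ i → i < j → C i
    start  : ∀ {i} → suc i ≡ x → ¬ C i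

record RightBlock (C : ℕ → Set) (j m : ℕ) : Set where
  field
    y      : ℕ
    j<y    : j < y
    y<m    : y < m
    closed : ∀ {i} → j < i → i < y → C i
    end    : suc y < m → ¬ C y

leftBlock : ∀ {C : ℕ → Set} → Decidable C → ∀ j → LeftBlock C j
leftBlock C? zero = record { x = 0 ; x≤j = z≤n ; closed = λ _ () ; start = λ () }
leftBlock {C} C? (suc j) with C? j
... | no ¬Cj = record { x = suc j ; x≤j = ≤-refl ; closed = λ x≤i i<j → contradiction x≤i (<⇒≱ i<j)
                      ; start = λ { refl → ¬Cj } }
... | yes Cj = record { x = x ; x≤j = m≤n⇒m≤1+n x≤j ; start = start ; closed = closed′ }
  where
  open LeftBlock (leftBlock C? j)
  closed′ : ∀ {i} → x ≤ i → i < suc j → C i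
  closed′ x≤i i<1+j with m<1+n⇒m<n∨m≡n i<1+j
  ... | inj₁ i<j  = closed x≤i i<j
  ... | inj₂ refl = Cj

rightBlock : ∀ {C : ℕ → Set} → Decidable C → ∀ d {j m} → suc j + suc d ≡ m → RightBlock C j m
rightBlock C? d {j} {m} eq = go d eq
  where
  single : suc j < m → (suc (suc j) < m → ¬ _) → RightBlock _ j m
  single lt end = record { y = suc j ; j<y = ≤-refl ; y<m = lt ; end = end
                         ; closed = λ j<i i<1+j → contradiction j<i (<⇒≱ i<1+j) }
  go : ∀ d → suc j + suc d ≡ m → RightBlock _ j m
  go zero eq = single (≤-reflexive (trans (+-comm 1 (suc j)) eq))
    λ lt → contradiction lt (≤⇒≯ (≤-reflexive (trans (sym eq) (+-comm (suc j) 1))))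
  go (suc d) eq with C? (suc j)
  ... | no ¬C = single (subst (suc (suc j) ≤_) eq (s≤s (subst (suc j ≤_) (sym (+-suc j (suc d))) (s≤s (m≤m+n j _))))) λ _ → ¬C
  ... | yes Cj+1 = record { y = y ; j<y = <⇒≤ j<y ; y<m = y<m ; end = end ; closed = closed′ }
    where
    open RightBlock (rightBlock C? d {suc j} (trans (cong suc (sym (+-suc j (suc d)))) eq))
    closed′ : ∀ {i} → j < i → i < y → _
    closed′ j<i i<y with m≤n⇒m<n∨m≡n j<i
    ... | inj₁ lt   = closed lt i<y
    ... | inj₂ refl = Cj+1

lastFailure : ∀ {Z : ℕ → Set} → Decidable Z → ∀ {x j} → x ≤ j → Z j →
  (∀ {i} → x ≤ i → i ≤ j → Z i) ⊎
  ∃ λ i → x ≤ i × i < j × ¬ Z i × (∀ {a} → i < a → a ≤ j → Z a)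
lastFailure {Z} Z? {x} {j} x≤j Zj = go (j ∸ x) (m∸n+n≡m x≤j)
  where
  go : ∀ d {x} → d + x ≡ j → (∀ {i} → x ≤ i → i ≤ j → Z i) ⊎
    ∃ λ i → x ≤ i × i < j × ¬ Z i × (∀ {a} → i < a → a ≤ j → Z a)
  go zero refl = inj₁ λ x≤i i≤x → subst Z (≤-antisym x≤i i≤x) Zj
  go (suc d) {x} eq with go d (trans (+-suc d x) eq)
  ... | inj₂ (i , x<i , rest) = inj₂ (i , <⇒≤ x<i , rest)
  ... | inj₁ all with Z? x
  ...   | no ¬Zx = inj₂ (x , ≤-refl , subst (x <_) eq (s≤s (m≤n+m x d)) , ¬Zx , all)
  ...   | yes Zx = inj₁ λ x≤i i≤j → case m≤n⇒m<n∨m≡n x≤i of λ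
          { (inj₁ x<i) → all x<i i≤j ; (inj₂ refl) → Zx }

-- Both searches return the index just left of the boundary. In the threshold shape this is the
-- position `q` that letter `j` will take.
firstFailure : ∀ {R : ℕ → Set} → Decidable R → ∀ {a y} → a ≤ y → R a →
  (∀ {i} → a ≤ i → i ≤ y → R i) ⊎
  ∃ λ i → a ≤ i × i < y × ¬ R (suc i) × (∀ {b} → a ≤ b → b ≤ i → R b)
firstFailure {R} R? {a} {y} a≤y Ra with m≤n⇒m<n∨m≡n a≤y
... | inj₂ refl = inj₁ λ a≤i i≤a → subst R (≤-antisym a≤i i≤a) Ra
firstFailure {R} R? {a} {suc y} _ Ra | inj₁ (s≤s a≤y) with firstFailure R? a≤y Ra
... | inj₂ (i , a≤i , i<y , rest) = inj₂ (i , a≤i , m<n⇒m<1+n i<y , rest)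
... | inj₁ all with R? (suc y)
...   | no ¬R = inj₂ (y , a≤y , ≤-refl , ¬R , all)
...   | yes r = inj₁ λ a≤i i≤1+y → case m≤n⇒m<n∨m≡n i≤1+y of λ
        { (inj₁ (s≤s i≤y)) → all a≤i i≤y ; (inj₂ refl) → r }

-- In `threshold` one value separates the two halves of the block, and a half of length one can be
-- placed exactly where the sequence crosses that value. In `peak` and `valley` all letters but one
-- are equal, so only that one has to be extremal.
data Slidable (m : ℕ) (p : ℕ → ℕ) (hi j x y : ℕ) : Set where
  threshold : (∀ {i} → x ≤ i → i ≤ j → p i ≡ 0) → (∀ {i} → j < i → i ≤ y → p i ≡ hi) →
              x ≡ j ⊎ y ≡ suc j →
              (∀ {a b} → a < m → b < m → 0 < p a → p a < hi → 0 < p b → p b < hi → a ≡ b) →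
              Slidable m p hi j x y
  peak      : (∀ {i} → i < m → i ≢ suc j → p i ≡ 0) → Slidable m p hi j x y
  valley    : (∀ {i} → i < m → i ≢ j → p i ≡ hi) → Slidable m p hi j x y

module Necessity {m : ℕ} {p : ℕ → ℕ} {C : ℕ → Set} {j : ℕ} (j+1<m : suc j < m) (Cj : C j)
                 (force : Forces m p (_≢ j) C)
                 {hi : ℕ} (p≤hi : ∀ {i} → i < m → p i ≤ hi) where

  open Insertion j+1<m Cj force

  private
    module Asc = Ascending m p
    module Des = Descending m p
    j<m : j < m
    j<m = <⇒≤ j+1<m

  extreme : ∀ {l h} → l < m → h < m → p l ≡ 0 → p h ≡ hi →
    ¬ ¬ ((p j ≡ 0 ⊎ p (suc j) ≡ 0) × (p j ≡ hi ⊎ p (suc j) ≡ hi))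
  extreme {l} {h} l<m h<m pl ph goal =
    -- As cut points, `0` precedes all keys and `suc hi * m` exceeds all of them.
    Single.single Asc.keys 0 λ o → Single.single Asc.keys (suc hi * m) λ o′ → goal
      ( [ (λ eq → inj₂ (bottom o j+1<m eq)) , (λ eq → inj₁ (bottom o j<m eq)) ]′ (Single.role Asc.keys 0 o)
      , [ (λ eq → inj₂ (top o′ j+1<m eq)) , (λ eq → inj₁ (top o′ j<m eq)) ]′ (Single.role Asc.keys (suc hi * m) o′))
    where
    bottom : ∀ o {i} → i < m → k o i ≡ suc j → p i ≡ 0
    bottom o {i} i<m eq = n≤0⇒n≡0 (subst (p i ≤_) pl (Single.bottom-role Asc.keys 0 o refl i<m l<m eq))
    top : ∀ o {i} → i < m → k o i ≡ suc j → p i ≡ hi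
    top o {i} i<m eq = ≤-antisym (p≤hi i<m) (subst (_≤ p i) ph
      (Single.top-role Asc.keys (suc hi * m) o (λ a<m → Asc.key< a<m (s≤s (p≤hi a<m))) i<m h<m eq))

  module Oriented (0<hi : 0 < hi) (p-left : p j ≡ 0) (p-right : p (suc j) ≡ hi)
                  (lb : LeftBlock C j) (rb : RightBlock C j m) where

    open LeftBlock lb renaming (closed to closedˡ)
    open RightBlock rb renaming (closed to closedʳ)

    private
      hi≰0 : ¬ hi ≤ 0
      hi≰0 = <⇒≱ 0<hi

      ≢hi⇒< : ∀ {i} → i < m → p i ≢ hi → p i < hi
      ≢hi⇒< i<m ne = ≤∧≢⇒< (p≤hi i<m) ne

    AllLo AllHi : Set
    AllLo = ∀ {i} → x ≤ i → i ≤ j → p i ≡ 0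
    AllHi = ∀ {i} → j < i → i ≤ y → p i ≡ hi

    module _ {n v} (o : Occ m p C n v) where

      block-left : ∀ N → k o j ≡ N + j → ∀ {i} → x ≤ i → i ≤ j → k o i ≡ N + i
      block-left N eq {i} x≤i i≤j = +-cancelʳ-≡ j _ _ (begin
        k o i + j  ≡⟨ rigid o i≤j j<m (λ i≤a a<j → closedˡ (≤-trans x≤i i≤a) a<j) ⟨
        k o j + i  ≡⟨ cong (_+ i) eq ⟩
        N + j + i  ≡⟨ +-assoc N j i ⟩
        N + (j + i) ≡⟨ cong (N +_) (+-comm j i) ⟩
        N + (i + j) ≡⟨ +-assoc N i j ⟨
        N + i + j  ∎)
        where open ≡-Reasoning

      block-right : k o (suc j) ≡ suc j → ∀ {i} → j < i → i ≤ y → k o i ≡ i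
      block-right eq {i} j<i i≤y = +-cancelʳ-≡ (suc j) _ _ (begin
        k o i + suc j   ≡⟨ rigid o j<i (≤-<-trans i≤y y<m) (λ j<a a<i → closedʳ j<a (<-≤-trans a<i i≤y)) ⟩
        k o (suc j) + i ≡⟨ cong (_+ i) eq ⟩
        suc j + i       ≡⟨ +-comm (suc j) i ⟩
        i + suc j       ∎)
        where open ≡-Reasoning

    -- An inserted value that plays a `hi` forces all middle letters below the cut; one that plays a
    -- `0` forces them above. Varying `E` then limits the middle letters.
    cut : ∀ {κ} → Keys m p κ → ∀ E → (∀ {i} → i < m → p i ≡ 0 → κ i < E) → (∀ {i} → i < m → p i ≡ hi → E ≤ κ i) →
      ¬ ¬ ((AllHi × (∀ {i} → i < m → p i < hi → κ i < E)) ⊎ (AllLo × (∀ {i} → i < m → 0 < p i → E ≤ κ i)))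
    cut {κ} K E lo<E E≤hi goal = single (goal ∘ split)
      where
      open Single K E
      split : Occ m p C (suc m) v →
        (AllHi × (∀ {i} → i < m → p i < hi → κ i < E)) ⊎ (AllLo × (∀ {i} → i < m → 0 < p i → E ≤ κ i))
      split o with role o
      ... | inj₁ eq = inj₁
        ((λ j<i i≤y → unshifted⇒hi j<i (≤-<-trans i≤y y<m) (block-right o eq j<i i≤y)) , nonhi<E)
        where open PlaysRight o eq p≤hi p-right E≤hi
      ... | inj₂ eq = inj₂
        ((λ {i} x≤i i≤j → shifted⇒lo (j ∸ i) (m∸n+n≡m i≤j) (block-left o 1 eq x≤i i≤j)) , E≤nonlo)
        where open PlaysLeft o eq p-left lo<E

    private
      -- `1 * m` puts all middle letters above the cut and `hi * m` puts them below. So either there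
      -- are none, or the first cut yields `AllLo` and the second `AllHi`.
      cut-low = cut Asc.keys (1 * m) (λ i<m eq → Asc.key< i<m (s≤s (≤-reflexive eq)))
                  (λ {i} _ eq → Asc.key≥ {i} (subst (1 ≤_) (sym eq) 0<hi))
      cut-high = cut Asc.keys (hi * m) (λ {i} i<m eq → Asc.key< {i} i<m (subst (_< hi) (sym eq) 0<hi))
                   (λ {i} _ eq → Asc.key≥ {i} (≤-reflexive (sym eq)))

    ¬lo⇒hi : ¬ AllLo → ¬ ¬ (∀ {i} → i < m → p i ≢ 0 → p i ≡ hi)
    ¬lo⇒hi ¬lo goal = cut-low λ
      { (inj₂ (lo , _)) → ¬lo lo
      ; (inj₁ (_ , below)) → goal λ {i} i<m ne → decidable-stable (p i ≟ hi) λ ne′ →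
          <⇒≱ (below i<m (≢hi⇒< i<m ne′)) (Asc.key≥ {i} (n≢0⇒n>0 ne)) }

    ¬hi⇒lo : ¬ AllHi → ¬ ¬ (∀ {i} → i < m → p i ≢ hi → p i ≡ 0)
    ¬hi⇒lo ¬hi goal = cut-high λ
      { (inj₁ (all-hi , _)) → ¬hi all-hi
      ; (inj₂ (_ , above)) → goal λ {i} i<m ne → decidable-stable (p i ≟ 0) λ ne′ →
          ≤⇒≯ (above i<m (n≢0⇒n>0 ne′)) (Asc.key< i<m (≢hi⇒< i<m ne)) }

    -- A cut just above the smaller of two middle keys would separate them, which neither outcome of
    -- `cut` allows.
    middle-unique : ∀ {a b} → a < m → b < m → 0 < p a → p a < hi → 0 < p b → p b < hi → a ≡ b
    middle-unique {a} {b} a<m b<m 0<a a<hi 0<b b<hi = decidable-stable (a ≟ b) λ a≢b →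
      case <-cmp (Asc.key a) (Asc.key b) of λ
        { (tri< lt _ _) → no-two a<m b<m 0<a a<hi b<hi lt
        ; (tri≈ _ eq _) → a≢b (Keys.injective Asc.keys a<m b<m eq)
        ; (tri> _ _ gt) → no-two b<m a<m 0<b b<hi a<hi gt }
      where
      no-two : ∀ {a b} → a < m → b < m → 0 < p a → p a < hi → p b < hi → ¬ Asc.key a < Asc.key b
      no-two {a} a<m b<m 0<a a<hi b<hi lt = cut Asc.keys (suc (Asc.key a))
        (λ {i} i<m eq → m<n⇒m<1+n (Keys.monotone Asc.keys i<m a<m (subst (_< p a) (sym eq) 0<a)))
        (λ {i} i<m eq → Keys.monotone Asc.keys a<m i<m (subst (p a <_) (sym eq) a<hi))
        λ { (inj₁ (_ , below)) → <⇒≱ lt (s≤s⁻¹ (below b<m b<hi))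
          ; (inj₂ (_ , above)) → <-irrefl refl (above a<m 0<a) }

    -- With at least two letters on each side, each of the three possible displacements of letter
    -- `j` makes a `hi` play the bottom value or a `0` play the top value.
    short-block : AllLo → AllHi → x < j → ¬ suc j < y
    short-block lo all-hi x<j j+1<y = double λ o → case k-j o of λ
      { (inj₁ eq) →
          let k₁ = trans (adj o j+1<m Cj) (cong suc eq)
              k₂ = trans (adj o j+2<m (closedʳ ≤-refl j+1<y)) (cong suc k₁)
          in hi≰0 (subst₂ _≤_ (all-hi (n≤1+n _) j+1<y) p-left (bottom-role top o j+2<m j<m k₂))
      ; (inj₂ (inj₁ eq)) → hi≰0 (subst₂ _≤_ p-right p-left (top-role top o j<m j+1<m eq))
      ; (inj₂ (inj₂ eq)) → preceding o eq refl x<j }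
      where
      open Double Asc.keys (m + hi * m)
      top : ∀ {i} → i < m → Asc.key i < suc (m + hi * m)
      top i<m = m<n⇒m<1+n (Asc.key< i<m (s≤s (p≤hi i<m)))
      j+2<m : suc (suc j) < m
      j+2<m = ≤-<-trans j+1<y y<m
      k-j : ∀ o → k o j ≡ j ⊎ k o j ≡ suc j ⊎ k o j ≡ suc (suc j)
      k-j o with m≤n⇒m<n∨m≡n (i≤k o j<m)
      ... | inj₂ eq = inj₁ (sym eq)
      ... | inj₁ lt with m≤n⇒m<n∨m≡n lt
      ...   | inj₂ eq  = inj₂ (inj₁ (sym eq))
      ...   | inj₁ lt′ = inj₂ (inj₂ (≤-antisym (k≤ 2 o j<m) lt′))
      preceding : ∀ o → k o j ≡ suc (suc j) → ∀ {a} → a ≡ j → x < a → ⊥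
      preceding o eq {suc i} refl (s≤s x≤i) = hi≰0 (subst₂ _≤_ p-right (lo x≤i (n≤1+n i))
        (top-role top o (<⇒≤ j<m) j+1<m (suc-injective (trans (sym (adj o j<m (closedˡ x≤i ≤-refl))) eq))))

    -- Here and in lo-unique a letter is played by its neighbour of a different
    -- value, and the ties among equal letters are broken so as to contradict this.
    hi-unique : ∀ {i} → j < i → i < y → p (suc i) ≢ hi → (∀ {a} → j < a → a ≤ i → p a ≡ hi) →
      ∀ {h} → h < m → p h ≡ hi → ¬ h ≢ i
    hi-unique {i} j<i i<y p-next hi-run {h} h<m ph h≢i with <-cmp h i
    ... | tri≈ _ eq _ = h≢i eq
    ... | tri< h<i _ _ = single λ o → case role o of λ
        { (inj₂ eq) → hi≰0 (subst₂ _≤_ p-right p-left (top-role o top j<m j+1<m eq))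
        ; (inj₁ eq) → <-asym (Asc.key-tie (≤-reflexive (trans ph (sym (hi-run j<i ≤-refl)))) h<i)
            (odd-<-odd⁻ (smaller o eq)) }
      where
      open Single Asc.keys (suc hi * m)
      top : ∀ {i} → i < m → Asc.key i < suc hi * m
      top i<m = Asc.key< i<m (s≤s (p≤hi i<m))
      1+i<m : suc i < m
      1+i<m = ≤-<-trans i<y y<m
      smaller : ∀ o → k o (suc j) ≡ suc j → odd Asc.key i < odd Asc.key h
      smaller o eq with h ≤? j
      ... | yes h≤j = subst₂ _<_
              (trans (cong v (block-right o eq (m<n⇒m<1+n j<i) i<y)) (v-right j<i))
              (trans (cong v (k-left o eq (m≤n⇒m≤1+n h≤j))) (v-left h≤j))
              (ord o 1+i<m h<m (<-≤-trans (≢hi⇒< 1+i<m p-next) (≤-reflexive (sym ph))))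
      ... | no h≰j = subst₂ _<_
              (trans (cong v (block-right o eq (m<n⇒m<1+n j<i) i<y)) (v-right j<i))
              (trans (cong v (block-right o eq (m<n⇒m<1+n (≰⇒> h≰j)) (≤-trans h<i (<⇒≤ i<y)))) (v-right (≰⇒> h≰j)))
              (ord o 1+i<m (≤-<-trans h<i (<-trans i<y y<m)) (<-≤-trans (≢hi⇒< 1+i<m p-next)
                (≤-reflexive (sym (hi-run (m<n⇒m<1+n (≰⇒> h≰j)) h<i)))))
    -- As `h` is not `i + 1`, letter `h` takes the value of some letter `a > i`, which descending
    -- ties put below letter `i`.
    ... | tri> _ _ h>i = single λ o → case role o of λ
        { (inj₂ eq) → hi≰0 (subst₂ _≤_ p-right p-left (top-role o top j<m j+1<m eq))
        ; (inj₁ eq) → larger o eq (k o h) refl }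
      where
      open Single Des.keys (suc hi * m)
      top : ∀ {i} → i < m → Des.key i < suc hi * m
      top i<m = Des.key< i<m (s≤s (p≤hi i<m))
      1+i<m : suc i < m
      1+i<m = ≤-<-trans i<y y<m
      1+i<h : suc i < h
      1+i<h = ≤∧≢⇒< h>i λ { refl → p-next ph }
      larger : ∀ o → k o (suc j) ≡ suc j → ∀ a → k o h ≡ a → ⊥
      larger o eq zero    ka = contradiction (≤-trans 1+i<h (subst (h ≤_) ka (i≤k o h<m))) λ ()
      larger o eq (suc a) ka = <-asym
        (Des.key-tie (≤-trans (p≤hi a<m) (≤-reflexive (sym (hi-run j<i ≤-refl)))) (∸-monoʳ-< (s≤s i<a) a<m))
        (odd-<-odd⁻ (subst₂ _<_
          (trans (cong v (block-right o eq (m<n⇒m<1+n j<i) i<y)) (v-right j<i))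
          (trans (cong v ka) (v-right (<-trans j<i i<a)))
          (ord o 1+i<m h<m (<-≤-trans (≢hi⇒< 1+i<m p-next) (≤-reflexive (sym ph))))))
        where
        i<a : i < a
        i<a = s≤s⁻¹ (≤-trans 1+i<h (subst (h ≤_) ka (i≤k o h<m)))
        a<m : a < m
        a<m = s≤s⁻¹ (subst (_< suc m) ka (bound o h<m))

    lo-unique : ∀ {i} → x ≤ i → i < j → p i ≢ 0 → (∀ {a} → i < a → a ≤ j → p a ≡ 0) →
      ∀ {h} → h < m → p h ≡ 0 → ¬ h ≢ suc i
    lo-unique {i} x≤i i<j p-prev lo-run {h} h<m ph h≢1+i with <-cmp h (suc i)
    ... | tri≈ _ eq _ = h≢1+i eq
    ... | tri> _ _ h>1+i = single λ o → case role o of λ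
        { (inj₁ eq) → hi≰0 (subst₂ _≤_ p-right p-left (bottom-role o refl j+1<m j<m eq))
        ; (inj₂ eq) → <-asym (Asc.key-tie (≤-reflexive (trans (lo-run ≤-refl i<j) (sym ph))) h>1+i)
            (odd-<-odd⁻ (smaller o eq h>1+i refl)) }
      where
      open Single Asc.keys 0
      i<m : i < m
      i<m = <-trans i<j j<m
      smaller : ∀ o → k o j ≡ suc j → ∀ {h′} → suc i < h′ → h′ ≡ h → odd Asc.key h < odd Asc.key (suc i)
      smaller o eq {suc h′} (s≤s i<h′) refl with suc h′ ≤? j
      ... | no h≰j = subst₂ _<_
              (trans (cong v (k-right o eq (<⇒≤ (≰⇒> h≰j)) h<m)) (v-right (≰⇒> h≰j)))
              (trans (cong v (block-left o 1 eq x≤i (<⇒≤ i<j))) (v-left i<j))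
              (ord o h<m i<m (subst (_< p i) (sym ph) (n≢0⇒n>0 p-prev)))
      ... | yes h≤j = subst₂ _<_
              (trans (cong v (block-left o 1 eq (≤-trans x≤i (<⇒≤ i<h′)) (<⇒≤ h≤j))) (v-left h≤j))
              (trans (cong v (block-left o 1 eq x≤i (<⇒≤ i<j))) (v-left i<j))
              (ord o (<⇒≤ h<m) i<m (subst (_< p i) (sym (lo-run i<h′ (<⇒≤ h≤j))) (n≢0⇒n>0 p-prev)))
    ... | tri< h<1+i _ _ = single λ o → case role o of λ
        { (inj₁ eq) → hi≰0 (subst₂ _≤_ p-right p-left (bottom-role o refl j+1<m j<m eq))
        ; (inj₂ eq) →
            let kh≤i = ≤-trans (k≤ 1 o h<m) h<i in
            <-asym (Des.key-tie (≤-trans (≤-reflexive (lo-run ≤-refl i<j)) z≤n)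
                     (∸-monoʳ-< (s≤s (s≤s kh≤i)) (≤-trans (s≤s i<j) j<m)))
              (odd-<-odd⁻ (subst₂ _<_
                (v-left (≤-trans kh≤i (<⇒≤ i<j)))
                (trans (cong v (block-left o 1 eq x≤i (<⇒≤ i<j))) (v-left i<j))
                (ord o h<m i<m (subst (_< p i) (sym ph) (n≢0⇒n>0 p-prev))))) }
      where
      open Single Des.keys 0
      i<m : i < m
      i<m = <-trans i<j j<m
      h<i : h < i
      h<i = ≤∧≢⇒< (s≤s⁻¹ h<1+i) λ { refl → p-prev ph }

    -- If a run of `hi` or `0` at the gap stops inside its block, the letter at its far end is the
    -- only one of its kind, so the run has length one. Middle letters are excluded as well, which
    -- leaves a peak or a valley.
    slidable : ¬ ¬ Slidable m p hi j x y
    slidable goal with lastFailure (λ i → p i ≟ 0) x≤j p-left | firstFailure (λ i → p i ≟ hi) j<y p-right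
    ... | inj₁ lo | inj₁ all-hi = goal (threshold lo all-hi short middle-unique)
      where
      short : x ≡ j ⊎ y ≡ suc j
      short with m≤n⇒m<n∨m≡n x≤j | m≤n⇒m<n∨m≡n j<y
      ... | inj₂ eq | _       = inj₁ eq
      ... | inj₁ _  | inj₂ eq = inj₂ (sym eq)
      ... | inj₁ lt | inj₁ lt′ = contradiction lt′ (short-block lo all-hi lt)
    ... | _ | inj₂ (i , j<i , i<y , p-next , hi-run) =
      ¬hi⇒lo (λ all → p-next (all (m<n⇒m<1+n j<i) i<y)) λ middle-free → goal (peak λ {h} h<m h≢1+j →
        middle-free h<m λ ph → h≢1+j (trans (unique h<m ph) (sym (unique j+1<m p-right))))
      where
      unique : ∀ {h} → h < m → p h ≡ hi → h ≡ i
      unique {h} h<m ph = decidable-stable (h ≟ i) (hi-unique j<i i<y p-next hi-run h<m ph)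
    ... | inj₂ (i , x≤i , i<j , p-prev , lo-run) | inj₁ _ =
      ¬lo⇒hi (λ all → p-prev (all x≤i (<⇒≤ i<j))) λ middle-free → goal (valley λ {h} h<m h≢j →
        middle-free h<m λ ph → h≢j (trans (unique h<m ph) (sym (unique j<m p-left))))
      where
      unique : ∀ {h} → h < m → p h ≡ 0 → h ≡ suc i
      unique {h} h<m ph = decidable-stable (h ≟ suc i) (lo-unique x≤i i<j p-prev lo-run h<m ph)

-- Sliding a block

sup : ℕ → (ℕ → ℕ) → ℕ
sup zero    f = 0
sup (suc n) f = f n ⊔ sup n f

≤-sup : ∀ {n} f {i} → i < n → f i ≤ sup n f
≤-sup {suc n} f i<1+n with m<1+n⇒m<n∨m≡n i<1+n
... | inj₁ i<n  = ≤-trans (≤-sup f i<n) (m≤n⊔m (f n) _)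
... | inj₂ refl = m≤m⊔n (f n) _

sup-≤ : ∀ {n} f {b} → (∀ {i} → i < n → f i ≤ b) → sup n f ≤ b
sup-≤ {zero}  f h = z≤n
sup-≤ {suc n} f h = ⊔-lub (h ≤-refl) (sup-≤ f (h ∘ m<n⇒m<1+n))

extremum : ∀ {_≲_ : Rel ℕ 0ℓ} → Total _≲_ → Transitive _≲_ → ∀ (v : ℕ → ℕ) {a b} → a < b →
  ∃ λ z → a ≤ z × z < b × (∀ {c} → a ≤ c → c < b → v c ≲ v z)
extremum {_≲_} total tr v {a} {suc b} (s≤s a≤b) with m≤n⇒m<n∨m≡n a≤b
... | inj₂ refl = a , ≤-refl , ≤-refl , λ {c} a≤c c≤a →
  subst (λ d → v d ≲ v a) (≤-antisym a≤c (s≤s⁻¹ c≤a)) ([ id , id ]′ (total (v a) (v a)))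
... | inj₁ a<b with extremum total tr v a<b
...   | z , a≤z , z<b , best with total (v z) (v b)
...     | inj₁ z≲b = b , a≤b , ≤-refl , λ a≤c c≤b → case m<1+n⇒m<n∨m≡n c≤b of λ
            { (inj₁ c<b) → tr (best a≤c c<b) z≲b ; (inj₂ refl) → [ id , id ]′ (total (v b) (v b)) }
...     | inj₂ b≲z = z , a≤z , m<n⇒m<1+n z<b , λ a≤c c≤b → case m<1+n⇒m<n∨m≡n c≤b of λ
            { (inj₁ c<b) → best a≤c c<b ; (inj₂ refl) → b≲z }

-- Closed gaps make the block occupy an interval of positions, so none between its ends is skipped.
block-hit : ∀ {m p C n v} (o : Occ m p C n v) → ∀ {a b c} → a ≤ b → b < m →
  (∀ {i} → a ≤ i → i < b → C i) → k o a ≤ c → c ≤ k o b → ∃ λ i → a ≤ i × i ≤ b × k o i ≡ c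
block-hit o {a} {b} a≤b b<m cl ka≤c c≤kb with m≤n⇒m<n∨m≡n a≤b | m≤n⇒m<n∨m≡n c≤kb
... | inj₂ refl | _       = a , ≤-refl , ≤-refl , ≤-antisym ka≤c c≤kb
... | inj₁ _    | inj₂ eq = b , a≤b , ≤-refl , sym eq
block-hit o {a} {suc b} _ b<m cl ka≤c _ | inj₁ (s≤s a≤b) | inj₁ c<kb
  with block-hit o a≤b (<⇒≤ b<m) (λ a≤i i<b → cl a≤i (m<n⇒m<1+n i<b)) ka≤c
         (s≤s⁻¹ (subst (_ <_) (adj o b<m (cl a≤b ≤-refl)) c<kb))
... | i , a≤i , i≤b , eq = i , a≤i , m≤n⇒m≤1+n i≤b , eq

-- Sliding the block x … y that contains gap j: gap j is closed by placing
-- letter j at position q and the rest of the block contiguously around it.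
module Slide {m : ℕ} {p : ℕ → ℕ} {C : ℕ → Set} {j : ℕ} (j+1<m : suc j < m)
             (lb : LeftBlock C j) (rb : RightBlock C j m)
             {n : ℕ} {v : ℕ → ℕ} (o : Occ m p (λ i → C i × i ≢ j) n v) where

  open LeftBlock lb renaming (closed to closedˡ)
  open RightBlock rb renaming (closed to closedʳ)

  private
    j<m : j < m
    j<m = <⇒≤ j+1<m

    closedˡ′ : ∀ {i} → x ≤ i → i < j → C i × i ≢ j
    closedˡ′ x≤i i<j = closedˡ x≤i i<j , <⇒≢ i<j

    closedʳ′ : ∀ {i} → j < i → i < y → C i × i ≢ j
    closedʳ′ j<i i<y = closedʳ j<i i<y , >⇒≢ j<i

    k-mono : ∀ {a b} → a < b → b < m → k o a < k o b
    k-mono = incr⇒mono (k o) (incr o)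

    k-mono-≤ : ∀ {a b} → a ≤ b → b < m → k o a ≤ k o b
    k-mono-≤ a≤b b<m with m≤n⇒m<n∨m≡n a≤b
    ... | inj₁ a<b  = <⇒≤ (k-mono a<b b<m)
    ... | inj₂ refl = ≤-refl

  module At {q : ℕ} (kj≤q : k o j ≤ q) (q<k : q < k o (suc j)) where

    -- The subtraction is exact, also for letters left of `j`, because `j ≤ k j ≤ q`.
    W : ℕ → ℕ
    W i = q + i ∸ j

    private
      j≤q+i : ∀ i → j ≤ q + i
      j≤q+i i = ≤-trans (≤-trans (i≤k o j<m) kj≤q) (m≤m+n q i)

    W-+ : ∀ i → W i + j ≡ q + i
    W-+ i = m∸n+n≡m (j≤q+i i)

    W-suc : ∀ i → W (suc i) ≡ suc (W i)
    W-suc i = trans (cong (_∸ j) (+-suc q i)) (+-∸-assoc 1 (j≤q+i i))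

    W-j : W j ≡ q
    W-j = m+n∸n≡m q j

    W≤q : ∀ {i} → i ≤ j → W i ≤ q
    W≤q {i} i≤j = subst (W i ≤_) W-j (∸-monoˡ-≤ j (+-monoʳ-≤ q i≤j))

    q<W : ∀ {i} → j < i → q < W i
    q<W {i} j<i = subst (_≤ W i) (trans (W-suc j) (cong suc W-j)) (∸-monoˡ-≤ j (+-monoʳ-≤ q j<i))

    -- The left half moves right and, by `W≤k`, the right half moves left. The block stays within
    -- the stretch that it spanned and cannot collide with outside letters.
    k≤W : ∀ {i} → x ≤ i → i ≤ j → k o i ≤ W i
    k≤W {i} x≤i i≤j = +-cancelʳ-≤ j _ _ (begin
      k o i + j  ≡⟨ rigid o i≤j j<m (λ i≤a a<j → closedˡ′ (≤-trans x≤i i≤a) a<j) ⟨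
      k o j + i  ≤⟨ +-monoˡ-≤ i kj≤q ⟩
      q + i      ≡⟨ W-+ i ⟨
      W i + j    ∎)
      where open ≤-Reasoning

    W≤k : ∀ {i} → j < i → i ≤ y → W i ≤ k o i
    W≤k {i} j<i i≤y = +-cancelʳ-≤ (suc j) _ _ (begin
      W i + suc j      ≡⟨ +-suc (W i) j ⟩
      suc (W i + j)    ≡⟨ cong suc (W-+ i) ⟩
      suc q + i        ≤⟨ +-monoˡ-≤ i q<k ⟩
      k o (suc j) + i  ≡⟨ rigid o j<i (≤-<-trans i≤y y<m) (λ j<a a<i → closedʳ′ j<a (<-≤-trans a<i i≤y)) ⟨
      k o i + suc j    ∎)
      where open ≤-Reasoning

    inWindow? : ∀ i → Dec (x ≤ i × i ≤ y)
    inWindow? i = (x ≤? i) ×-dec (i ≤? y)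

    k′ : ℕ → ℕ
    k′ i with inWindow? i
    ... | yes _ = W i
    ... | no  _ = k o i

    -- Sorts the new positions by what is known of their values. Positions used by `o` inherit its
    -- inequalities, with block letters staying in their own half; those between `k j` and
    -- `k (j + 1)` are controlled by the choice of `q`.
    data Position (i : ℕ) : ℕ → Set where
      unmoved  : ¬ (x ≤ i × i ≤ y) → Position i (k o i)
      stayedˡ  : ∀ {a} → x ≤ i → i ≤ j → x ≤ a → a ≤ j → Position i (k o a)
      stayedʳ  : ∀ {a} → j < i → i ≤ y → j < a → a ≤ y → Position i (k o a)
      movedˡ   : x ≤ i → i ≤ j → k o j ≤ W i → W i ≤ q → Position i (W i)
      movedʳ   : j < i → i ≤ y → q < W i → W i ≤ k o (suc j) → Position i (W i)

    position : ∀ i → Position i (k′ i)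
    position i with inWindow? i
    ... | no out = unmoved out
    ... | yes (x≤i , i≤y) with i ≤? j
    position i | yes (x≤i , i≤y) | yes i≤j with k o j ≤? W i
    ...   | yes kj≤W = movedˡ x≤i i≤j kj≤W (W≤q i≤j)
    ...   | no  kj≰W with block-hit o x≤j j<m closedˡ′
                           (≤-trans (k-mono-≤ x≤i (≤-<-trans i≤j j<m)) (k≤W x≤i i≤j)) (<⇒≤ (≰⇒> kj≰W))
    ...     | a , x≤a , a≤j , eq = subst (Position i) eq (stayedˡ x≤i i≤j x≤a a≤j)
    position i | yes (x≤i , i≤y) | no i≰j with W i ≤? k o (suc j)
    ...   | yes W≤kj = movedʳ (≰⇒> i≰j) i≤y (q<W (≰⇒> i≰j)) W≤kj
    ...   | no  W≰kj with block-hit o j<y y<m closedʳ′ (<⇒≤ (≰⇒> W≰kj))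
                           (≤-trans (W≤k (≰⇒> i≰j) i≤y) (k-mono-≤ i≤y y<m))
    ...     | a , j<a , a≤y , eq = subst (Position i) eq (stayedʳ (≰⇒> i≰j) i≤y j<a a≤y)

    k′-in : ∀ {i} → x ≤ i → i ≤ y → k′ i ≡ W i
    k′-in {i} x≤i i≤y with inWindow? i
    ... | yes _   = refl
    ... | no  out = contradiction (x≤i , i≤y) out

    k′-incr : ∀ {i} → suc i < m → k′ i < k′ (suc i)
    k′-incr {i} 1+i<m with inWindow? i | inWindow? (suc i)
    ... | yes _ | yes _ = ≤-reflexive (sym (W-suc i))
    ... | no _  | no _  = incr o 1+i<m
    ... | yes (x≤i , i≤y) | no out = ≤-<-trans (W≤k (<-≤-trans j<y y≤i) i≤y) (incr o 1+i<m)
      where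
      y≤i : y ≤ i
      y≤i = s≤s⁻¹ (≰⇒> λ 1+i≤y → out (m≤n⇒m≤1+n x≤i , 1+i≤y))
    ... | no out | yes (x≤1+i , 1+i≤y) = <-≤-trans (incr o 1+i<m) (k≤W x≤1+i (≤-trans 1+i≤x x≤j))
      where
      1+i≤x : suc i ≤ x
      1+i≤x = ≰⇒> λ x≤i → out (x≤i , <⇒≤ 1+i≤y)

    k′-adj : ∀ {i} → suc i < m → C i → k′ (suc i) ≡ suc (k′ i)
    k′-adj {i} 1+i<m Ci with inWindow? i | inWindow? (suc i)
    ... | yes _ | yes _ = W-suc i
    ... | no out | no _ = adj o 1+i<m (Ci , λ { refl → out (x≤j , <⇒≤ j<y) })
    -- By maximality the gaps at both ends of the block are not closed, so no adjacency is owed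
    -- there.
    ... | yes (x≤i , i≤y) | no out with refl ← ≤-antisym i≤y (s≤s⁻¹ (≰⇒> λ 1+i≤y → out (m≤n⇒m≤1+n x≤i , 1+i≤y)))
        = contradiction Ci (end 1+i<m)
    k′-adj {i} 1+i<m Ci | no out | yes (x≤1+i , 1+i≤y) = contradiction Ci
      (start (≤-antisym (≰⇒> λ x≤i → out (x≤i , <⇒≤ 1+i≤y)) x≤1+i))

    k′-bound : ∀ {i} → i < m → k′ i < n
    k′-bound {i} i<m with k′ i | position i
    ... | _ | unmoved _          = bound o i<m
    ... | _ | stayedˡ _ _ _ a≤j  = bound o (≤-<-trans a≤j j<m)
    ... | _ | stayedʳ _ _ _ a≤y  = bound o (≤-<-trans a≤y y<m)
    ... | _ | movedˡ _ _ _ W≤q   = ≤-<-trans W≤q (<-trans q<k (bound o j+1<m))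
    ... | _ | movedʳ _ _ _ W≤k   = ≤-<-trans W≤k (bound o j+1<m)

    slide : (∀ {i i′} → i < m → i′ < m → p i < p i′ → v (k′ i) < v (k′ i′)) → Occ m p C n v
    slide h = record { k = k′ ; bound = k′-bound ; incr = k′-incr ; adj = k′-adj ; ord = h }

    v∘k′-injective : Injective< n v → ∀ {a b} → a < m → b < m → v (k′ a) ≡ v (k′ b) → a ≡ b
    v∘k′-injective inj {a} {b} a<m b<m eq with <-cmp a b
    ... | tri< a<b _ _ = contradiction (inj (k′-bound a<m) (k′-bound b<m) eq) (<⇒≢ (incr⇒mono k′ k′-incr a<b b<m))
    ... | tri≈ _ e _   = e
    ... | tri> _ _ b<a = contradiction (inj (k′-bound a<m) (k′-bound b<m) eq) (>⇒≢ (incr⇒mono k′ k′-incr b<a a<m))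

  module _ (inj : Injective< n v) {hi : ℕ} (p≤hi : ∀ {i} → i < m → p i ≤ hi)
           (0<hi : 0 < hi) (p-left : p j ≡ 0) (p-right : p (suc j) ≡ hi) where

    private
      0≢hi : ∀ {i} → p i ≡ 0 → p i ≢ hi
      0≢hi eq eq′ = <⇒≢ 0<hi (trans (sym eq) eq′)

    module Threshold (all-lo : ∀ {i} → x ≤ i → i ≤ j → p i ≡ 0) (all-hi : ∀ {i} → j < i → i ≤ y → p i ≡ hi)
                     (middle-unique : ∀ {a b} → a < m → b < m → 0 < p a → p a < hi → 0 < p b → p b < hi → a ≡ b) where

      -- Chosen so that the supremum `θ` is the value of the middle letter if there is one, and
      -- otherwise one more than the largest value playing a `0`.
      lowerBound : ℕ → ℕ
      lowerBound i with p i ≟ 0 | p i ≟ hi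
      ... | yes _ | _     = suc (v (k o i))
      ... | no _  | yes _ = 0
      ... | no _  | no _  = v (k o i)

      θ : ℕ
      θ = sup m lowerBound

      lo<θ : ∀ {i} → i < m → p i ≡ 0 → v (k o i) < θ
      lo<θ {i} i<m eq with p i ≟ 0 | p i ≟ hi | ≤-sup {m} lowerBound i<m
      ... | yes _ | _ | le = le
      ... | no ne | _ | _  = contradiction eq ne

      θ≤hi : ∀ {i} → i < m → p i ≡ hi → θ ≤ v (k o i)
      θ≤hi {i} i<m eq = sup-≤ lowerBound bounded
        where
        bounded : ∀ {a} → a < m → lowerBound a ≤ v (k o i)
        bounded {a} a<m with p a ≟ 0 | p a ≟ hi
        ... | yes e | _     = ord o a<m i<m (subst₂ _<_ (sym e) (sym eq) 0<hi)
        ... | no _  | yes _ = z≤n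
        ... | no _  | no ne = <⇒≤ (ord o a<m i<m (subst (p a <_) (sym eq) (≤∧≢⇒< (p≤hi a<m) ne)))

      middle≡θ : ∀ {i} → i < m → p i ≢ 0 → p i ≢ hi → v (k o i) ≡ θ
      middle≡θ {i} i<m ≢0 ≢hi = ≤-antisym i≤θ (sup-≤ lowerBound bounded)
        where
        i≤θ : v (k o i) ≤ θ
        i≤θ with p i ≟ 0 | p i ≟ hi | ≤-sup {m} lowerBound i<m
        ... | yes e | _     | _  = contradiction e ≢0
        ... | no _  | yes e | _  = contradiction e ≢hi
        ... | no _  | no _  | le = le
        bounded : ∀ {a} → a < m → lowerBound a ≤ v (k o i)
        bounded {a} a<m with p a ≟ 0 | p a ≟ hi
        ... | yes e | _     = ord o a<m i<m (subst (_< p i) (sym e) (n≢0⇒n>0 ≢0))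
        ... | no _  | yes _ = z≤n
        ... | no a≢0 | no a≢hi = ≤-reflexive (cong (v ∘ k o) (middle-unique a<m i<m
                (n≢0⇒n>0 a≢0) (≤∧≢⇒< (p≤hi a<m) a≢hi) (n≢0⇒n>0 ≢0) (≤∧≢⇒< (p≤hi i<m) ≢hi)))

      module _ {q : ℕ} (kj≤q : k o j ≤ q) (q<k : q < k o (suc j)) where
        open At kj≤q q<k

        -- Block letters are all `0` or `hi`, so a middle letter lies outside and keeps its value
        -- `θ`. Only the new positions between `k j` and `k (j + 1)` remain to be checked.
        crossing : (∀ {i} → x ≤ i → i ≤ j → k o j ≤ W i → W i ≤ q → v (W i) < θ) →
                   (∀ {i} → j < i → i ≤ y → q < W i → W i ≤ k o (suc j) → θ ≤ v (W i)) → Occ m p C n v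
        crossing below above = slide ordered
          where
          lo : ∀ {i} → i < m → p i ≡ 0 → v (k′ i) < θ
          lo {i} i<m eq with k′ i | position i
          ... | _ | unmoved _             = lo<θ i<m eq
          ... | _ | stayedˡ _ _ x≤a a≤j   = lo<θ (≤-<-trans a≤j j<m) (all-lo x≤a a≤j)
          ... | _ | movedˡ x≤i i≤j ≤W W≤  = below x≤i i≤j ≤W W≤
          ... | _ | stayedʳ j<i i≤y _ _   = contradiction (all-hi j<i i≤y) (0≢hi eq)
          ... | _ | movedʳ j<i i≤y _ _    = contradiction (all-hi j<i i≤y) (0≢hi eq)

          high : ∀ {i} → i < m → p i ≡ hi → θ ≤ v (k′ i)
          high {i} i<m eq with k′ i | position i
          ... | _ | unmoved _             = θ≤hi i<m eq
          ... | _ | stayedʳ _ _ j<a a≤y   = θ≤hi (≤-<-trans a≤y y<m) (all-hi j<a a≤y)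
          ... | _ | movedʳ j<i i≤y ≤W W≤  = above j<i i≤y ≤W W≤
          ... | _ | stayedˡ x≤i i≤j _ _   = contradiction eq (0≢hi (all-lo x≤i i≤j))
          ... | _ | movedˡ x≤i i≤j _ _    = contradiction eq (0≢hi (all-lo x≤i i≤j))

          middle : ∀ {i} → i < m → p i ≢ 0 → p i ≢ hi → v (k′ i) ≡ θ
          middle {i} i<m ≢0 ≢hi with k′ i | position i
          ... | _ | unmoved _             = middle≡θ i<m ≢0 ≢hi
          ... | _ | stayedʳ j<i i≤y _ _   = contradiction (all-hi j<i i≤y) ≢hi
          ... | _ | movedʳ j<i i≤y _ _    = contradiction (all-hi j<i i≤y) ≢hi
          ... | _ | stayedˡ x≤i i≤j _ _   = contradiction (all-lo x≤i i≤j) ≢0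
          ... | _ | movedˡ x≤i i≤j _ _    = contradiction (all-lo x≤i i≤j) ≢0

          ordered : ∀ {a b} → a < m → b < m → p a < p b → v (k′ a) < v (k′ b)
          ordered {a} {b} a<m b<m lt with p a ≟ 0 | p b ≟ hi
          ... | yes e | yes e′ = <-≤-trans (lo a<m e) (high b<m e′)
          ... | yes e | no ≢hi = <-≤-trans (lo a<m e) (≤-reflexive (sym (middle b<m (>⇒≢ (≤-<-trans z≤n lt)) ≢hi)))
          -- The bounds only give `≤` at `θ`; strictness comes from distinct positions and the
          -- injectivity of `v`.
          ... | no ≢0 | yes e′ = ≤∧≢⇒< (≤-trans (≤-reflexive (middle a<m ≢0 a≢hi)) (high b<m e′))
              λ eq → <-irrefl (cong p (v∘k′-injective inj a<m b<m eq)) lt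
            where
            a≢hi : p a ≢ hi
            a≢hi e = <⇒≢ lt (trans e (sym e′))
          ... | no ≢0 | no ≢hi = contradiction (cong p (middle-unique a<m b<m (n≢0⇒n>0 ≢0)
                  (<-≤-trans lt (p≤hi b<m)) (≤-<-trans z≤n lt) (≤∧≢⇒< (p≤hi b<m) ≢hi))) (<⇒≢ lt)

      private
        kj<θ : v (k o j) < θ
        kj<θ = lo<θ j<m p-left
        θ≤kj+1 : θ ≤ v (k o (suc j))
        θ≤kj+1 = θ≤hi j+1<m p-right
        kj<kj+1 : k o j < k o (suc j)
        kj<kj+1 = incr o j+1<m

      -- The left half is letter `j` alone. With `q` the last position before `k (j + 1)` whose
      -- value is below `θ`, the right half meets only values of at least `θ`.
      short-left : x ≡ j → Occ m p C n v
      short-left refl with lastFailure (λ c → θ ≤? v c) (<⇒≤ kj<kj+1) θ≤kj+1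
      ... | inj₁ all = contradiction (all ≤-refl (<⇒≤ kj<kj+1)) (<⇒≱ kj<θ)
      ... | inj₂ (q , kj≤q , q<k , low , above) = crossing kj≤q q<k
        (λ x≤i i≤j _ _ → subst (λ c → v c < θ)
           (sym (trans (cong (At.W kj≤q q<k) (≤-antisym i≤j x≤i)) (At.W-j kj≤q q<k))) (≰⇒> low))
        (λ _ _ q<W W≤k → above q<W W≤k)

      short-right : y ≡ suc j → Occ m p C n v
      short-right eq with firstFailure (λ c → v c <? θ) (<⇒≤ kj<kj+1) kj<θ
      ... | inj₁ all = contradiction θ≤kj+1 (<⇒≱ (all (<⇒≤ kj<kj+1) ≤-refl))
      ... | inj₂ (q , kj≤q , q<k , high , below) = crossing kj≤q q<k
        (λ _ _ kj≤W W≤q → below kj≤W W≤q)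
        (λ j<i i≤y _ _ → subst (λ c → θ ≤ v c)
           (sym (trans (cong (At.W kj≤q q<k) (≤-antisym (subst (_ ≤_) eq i≤y) j<i))
                       (trans (At.W-suc kj≤q q<k j) (cong suc (At.W-j kj≤q q<k))))) (≮⇒≥ high))

    peak-occurrence : (∀ {i} → i < m → i ≢ suc j → p i ≡ 0) → Occ m p C n v
    peak-occurrence flat with extremum ≤-total ≤-trans v {suc (k o j)} {suc (k o (suc j))} (s≤s (incr o j+1<m))
    -- The interval contains `k (j + 1)` but not `k j`, so the position before its maximum is
    -- admissible for letter `j`. Only comparisons with letter `j + 1` matter, and that letter lands
    -- on the maximum.
    ... | suc q , s≤s kj≤q , s≤s q<k , best = slide ordered
      where
      open At kj≤q q<k
      k′-top : k′ (suc j) ≡ suc q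
      k′-top = trans (k′-in (m≤n⇒m≤1+n x≤j) j<y) (trans (W-suc j) (cong suc W-j))
      top : v (k o (suc j)) ≤ v (suc q)
      top = best (incr o j+1<m) ≤-refl
      below-top : ∀ {a} → a < m → a ≢ suc j → v (k o a) ≤ v (suc q)
      below-top a<m ne = ≤-trans (<⇒≤ (ord o a<m j+1<m (subst₂ _<_ (sym (flat a<m ne)) (sym p-right) 0<hi))) top
      bounded : ∀ {i} → i < m → v (k′ i) ≤ v (suc q)
      bounded {i} i<m with i ≟ suc j
      ... | yes refl = ≤-reflexive (cong v k′-top)
      ... | no ne with k′ i | position i
      ...   | _ | unmoved _            = below-top i<m ne
      ...   | _ | stayedˡ _ _ _ a≤j    = below-top (≤-<-trans a≤j j<m) (<⇒≢ (s≤s a≤j))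
      ...   | _ | movedˡ x≤i i≤j kj≤W W≤q with m≤n⇒m<n∨m≡n kj≤W
      ...     | inj₁ kj<W = best kj<W (s≤s (≤-trans W≤q (<⇒≤ q<k)))
      ...     | inj₂ eq   = subst (λ c → v c ≤ v (suc q)) eq (below-top j<m (<⇒≢ ≤-refl))
      bounded {i} i<m | no ne | _ | movedʳ _ _ q<W W≤k = best (≤-<-trans kj≤q q<W) (s≤s W≤k)
      bounded {i} i<m | no ne | _ | stayedʳ {a} _ _ _ a≤y with a ≟ suc j
      ...     | yes refl = top
      ...     | no ne′   = below-top (≤-<-trans a≤y y<m) ne′
      ordered : ∀ {a b} → a < m → b < m → p a < p b → v (k′ a) < v (k′ b)
      ordered {a} {b} a<m b<m lt with b ≟ suc j
      ... | yes refl = ≤∧≢⇒< (≤-trans (bounded a<m) (≤-reflexive (sym (cong v k′-top))))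
                         λ eq → <-irrefl (cong p (v∘k′-injective inj a<m b<m eq)) lt
      ... | no ne    = contradiction (flat b<m ne) (>⇒≢ (≤-<-trans z≤n lt))

    valley-occurrence : (∀ {i} → i < m → i ≢ j → p i ≡ hi) → Occ m p C n v
    valley-occurrence flat with extremum {_≥_} (flip ≤-total) (flip ≤-trans) v (incr o j+1<m)
    ... | q , kj≤q , q<k , best = slide ordered
      where
      open At kj≤q q<k
      k′-bottom : k′ j ≡ q
      k′-bottom = trans (k′-in x≤j (<⇒≤ j<y)) W-j
      bottom : v q ≤ v (k o j)
      bottom = best ≤-refl (incr o j+1<m)
      above-bottom : ∀ {a} → a < m → a ≢ j → v q ≤ v (k o a)
      above-bottom a<m ne = ≤-trans bottom (<⇒≤ (ord o j<m a<m (subst₂ _<_ (sym p-left) (sym (flat a<m ne)) 0<hi)))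
      bounded : ∀ {i} → i < m → v q ≤ v (k′ i)
      bounded {i} i<m with i ≟ j
      ... | yes refl = ≤-reflexive (sym (cong v k′-bottom))
      ... | no ne with k′ i | position i
      ...   | _ | unmoved _            = above-bottom i<m ne
      ...   | _ | stayedʳ _ _ j<a a≤y  = above-bottom (≤-<-trans a≤y y<m) (>⇒≢ j<a)
      ...   | _ | movedˡ _ _ kj≤W W≤q  = best kj≤W (≤-<-trans W≤q q<k)
      ...   | _ | movedʳ j<i i≤y q<W W≤k with m≤n⇒m<n∨m≡n W≤k
      ...     | inj₁ W<k = best (≤-trans kj≤q (<⇒≤ q<W)) W<k
      ...     | inj₂ eq  = subst (λ c → v q ≤ v c) (sym eq) (above-bottom j+1<m (>⇒≢ ≤-refl))
      bounded {i} i<m | no ne | _ | stayedˡ {a} _ _ _ a≤j with a ≟ j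
      ...     | yes refl = bottom
      ...     | no ne′   = above-bottom (≤-<-trans a≤j j<m) ne′
      ordered : ∀ {a b} → a < m → b < m → p a < p b → v (k′ a) < v (k′ b)
      ordered {a} {b} a<m b<m lt with a ≟ j
      ... | yes refl = ≤∧≢⇒< (≤-trans (≤-reflexive (cong v k′-bottom)) (bounded b<m))
                         λ eq → <-irrefl (cong p (v∘k′-injective inj a<m b<m eq)) lt
      ... | no ne    = contradiction (p≤hi b<m) (<⇒≱ (subst (_< p b) (flat a<m ne) lt))

    slidable⇒occurrence : Slidable m p hi j x y → Occ m p C n v
    slidable⇒occurrence (threshold all-lo all-hi short unique) =
      [ short-left , short-right ]′ short
      where open Threshold all-lo all-hi unique
    slidable⇒occurrence (peak flat)   = peak-occurrence flat
    slidable⇒occurrence (valley flat) = valley-occurrence flat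

-- Words and dashes

Reverses : ℕ → (p p′ : ℕ → ℕ) → Set
Reverses m p p′ = ∀ {a b} → a < m → b < m → p a < p b → p′ b < p′ a

-- Complementing the values against their supremum reverses every comparison and keeps the
-- positions. A descent at gap `j` can thus be treated as an ascent.
forces-reverse : ∀ {m p p′ C C′} → Reverses m p p′ → Reverses m p′ p → Forces m p C C′ → Forces m p′ C C′
forces-reverse {m} {p} {p′} p→p′ p′→p force {n} {v} inj o none =
  force inj′ (recolour o λ a<m b<m lt → v→v′ (bound o b<m) (bound o a<m) (ord o b<m a<m (p→p′ a<m b<m lt)))
    λ o′ → none (recolour o′ λ a<m b<m lt → ∸-cancelʳ-< (ord o′ b<m a<m (p′→p a<m b<m lt)))
  where
  v′ : ℕ → ℕ
  v′ a = sup n v ∸ v a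
  v→v′ : ∀ {a b} → a < n → b < n → v a < v b → v′ b < v′ a
  v→v′ _ b<n lt = ∸-monoʳ-< lt (≤-sup v b<n)
  inj′ : Injective< n v′
  inj′ a<n b<n eq = inj a<n b<n (∸-cancelˡ-≡ (≤-sup v a<n) (≤-sup v b<n) eq)

module _ {m : ℕ} {C : ℕ → Set} (C? : Decidable C) {j : ℕ} (j+1<m : suc j < m) (Cj : C j) {hi : ℕ} (0<hi : 0 < hi) where

  close-ascent : ∀ {p} → (∀ {i} → i < m → p i ≤ hi) → p j ≡ 0 → p (suc j) ≡ hi →
    Forces m p (_≢ j) C → Forces m p (λ i → C i × i ≢ j) C
  close-ascent p≤hi pj pj+1 force inj o none =
    slidable λ s → none (Slide.slidable⇒occurrence j+1<m lb rb o inj p≤hi 0<hi pj pj+1 s)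
    where
    lb : LeftBlock C j
    lb = leftBlock C? j
    rb : RightBlock C j m
    rb with d , eq ← m≤n⇒∃[o]m+o≡n j+1<m = rightBlock C? d (trans (cong suc (+-suc j d)) eq)
    open Necessity j+1<m Cj force p≤hi
    open Oriented 0<hi pj pj+1 lb rb

  close : ∀ {p} → (∀ {i} → i < m → p i ≤ hi) → (∃ λ l → l < m × p l ≡ 0) → (∃ λ h → h < m × p h ≡ hi) →
    Forces m p (_≢ j) C → Forces m p (λ i → C i × i ≢ j) C
  close {p} p≤hi (l , l<m , pl) (h , h<m , ph) force inj o none =
    Necessity.extreme j+1<m Cj force p≤hi l<m h<m pl ph λ
      { (inj₁ pj , inj₂ pj+1) → close-ascent p≤hi pj pj+1 force inj o none
      ; (inj₂ pj+1 , inj₁ pj) → forces-reverse p′→p p→p′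
          (close-ascent (λ {i} _ → m∸n≤m hi (p i)) (trans (cong (hi ∸_) pj) (n∸n≡0 hi)) (cong (hi ∸_) pj+1)
            (forces-reverse p→p′ p′→p force)) inj o none
      ; (inj₁ pj , inj₁ pj′) → <⇒≢ 0<hi (trans (sym pj) pj′)
      ; (inj₂ pj+1 , inj₂ pj+1′) → <⇒≢ 0<hi (trans (sym pj+1) pj+1′)
      }
    where
    p→p′ : Reverses m p (λ i → hi ∸ p i)
    p→p′ _ b<m lt = ∸-monoʳ-< lt (p≤hi b<m)
    p′→p : Reverses m (λ i → hi ∸ p i) p
    p′→p {a} {b} _ _ lt = ∸-cancelʳ-< {p a} {p b} {hi} lt

-- The avoiders determine the word

wordℕ<r : ∀ P {i} → i < length P → wordℕ P i < r P
wordℕ<r P = ∀<-intro (λ i → wordℕ P i < r P)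
  λ i → subst (_< r P) (sym (nth-map 0 toℕ (word P) i)) (FP.toℕ<n _)

wordℕ-onto : ∀ P {a} → a < r P → ∃ λ i → i < length P × wordℕ P i ≡ a
wordℕ-onto P@(mkPattern _ _ w _ onto) = ∀<-intro (λ a → ∃ λ i → i < length P × wordℕ P i ≡ a) λ a →
  -- `onto` is irrelevant, so the membership proof is recomputed by search before its index is used.
  let a∈w = recompute (Any.any? (a FP.≟_) w) (onto a) in
  toℕ (Any.index a∈w) , FP.toℕ<n _ , trans (nth-map 0 toℕ w _) (cong toℕ (sym (Any.lookup-index a∈w)))

ownOccurrence : ∀ {m p C κ} → Keys m p κ → Occ m p C m κ
ownOccurrence K = record { k = id ; bound = id ; incr = λ _ → ≤-refl ; adj = λ _ _ → refl ; ord = Keys.monotone K }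

-- A linear extension of `P` contains `P`, hence `Q`, and so it offers at least as many positions as
-- `Q` has letters.
length-≤ : ∀ P Q → Av Q ⊆ᵖ Av P → length Q ≤ length P
length-≤ P Q sub = decidable-stable (length Q ≤? length P) λ ≰ →
  forced-occurrence _ (Keys.injective keys) P Q (λ _ → sub) (ownOccurrence keys)
    λ o → ≰ (≤-<-trans (i≤k o ≤-refl) (bound o ≤-refl))
  where open Ascending (length P) (wordℕ P)

-- At equal lengths an occurrence uses every position in order, so each linear extension of `P` is
-- one of `Q`. If `P` does not put letter `a` below letter `b`, some tie-break puts it above,
-- against the order in `Q`.
order-reflects : ∀ P Q → gaps Q ≡ gaps P → Av Q ⊆ᵖ Av P →
  ∀ {a b} → a < length P → b < length P → wordℕ Q a < wordℕ Q b → wordℕ P a < wordℕ P b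
order-reflects P@(mkPattern _ _ _ _ _) Q@(mkPattern _ _ _ _ _) refl sub {a} {b} a<m b<m lt =
  decidable-stable (wordℕ P a <? wordℕ P b) λ ≮ → case <-cmp a b of λ
    { (tri< a<b _ _) → refute Des.keys (Des.key-tie (≮⇒≥ ≮) (∸-monoʳ-< (s≤s a<b) b<m))
    ; (tri≈ _ refl _) → <-irrefl refl lt
    ; (tri> _ _ b<a) → refute Asc.keys (Asc.key-tie (≮⇒≥ ≮) b<a) }
  where
  module Asc = Ascending (length P) (wordℕ P)
  module Des = Descending (length P) (wordℕ P)
  refute : ∀ {κ} → Keys (length P) (wordℕ P) κ → ¬ κ b < κ a
  refute {κ} K gt = forced-occurrence κ (Keys.injective K) P Q (λ _ → sub) (ownOccurrence K) λ o →
    let k≡ = λ {i} (i<m : i < length P) → ≤-antisym (k≤ 0 o i<m) (i≤k o i<m) in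
    <-asym gt (subst₂ (λ c d → κ c < κ d) (k≡ a<m) (k≡ b<m) (ord o a<m b<m lt))

-- A letter exceeds all smaller ones, so a word is determined by the order of its letters.
word-≤ : ∀ P Q → (∀ {a b} → a < length P → b < length P → wordℕ P a < wordℕ P b → wordℕ Q a < wordℕ Q b) →
  ∀ c {i} → i < length P → wordℕ P i ≡ c → c ≤ wordℕ Q i
word-≤ P Q mono zero    i<m eq = z≤n
word-≤ P Q mono (suc c) {i} i<m eq
  with l , l<m , pl ← wordℕ-onto P (<-trans (n<1+n c) (subst (_< r P) eq (wordℕ<r P i<m)))
  = ≤-<-trans (word-≤ P Q mono c l<m pl) (mono l<m i<m (subst₂ _<_ (sym pl) (sym eq) (n<1+n c)))

r-≤ : ∀ P Q → gaps P ≡ gaps Q → (∀ {i} → i < length P → wordℕ P i ≡ wordℕ Q i) → r P ≤ r Q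
r-≤ P Q geq same = ≮⇒≥ λ lt → case wordℕ-onto P lt of λ
  { (i , i<m , eq) → <-irrefl refl (subst (_< r Q) (trans (sym (same i<m)) eq)
      (wordℕ<r Q (subst (λ g → i < suc g) geq i<m))) }

setDashes : (P : Pattern) → Subset (gaps P) → Pattern
setDashes (mkPattern r g w _ o) d = mkPattern r g w d o

letters-determine : ∀ {r n} (w w′ : Vec (Fin r) n) →
  (∀ {i} → i < n → nth 0 (V.map toℕ w) i ≡ nth 0 (V.map toℕ w′) i) → w ≡ w′
letters-determine w w′ same = begin
  w                    ≡⟨ VP.tabulate∘lookup w ⟨
  tabulate (lookup w)  ≡⟨ VP.tabulate-cong (λ i → FP.toℕ-injective
                            (trans (sym (nth-map 0 toℕ w i)) (trans (same (FP.toℕ<n i)) (nth-map 0 toℕ w′ i)))) ⟩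
  tabulate (lookup w′) ≡⟨ VP.tabulate∘lookup w′ ⟩
  w′                   ∎
  where open ≡-Reasoning

sameWord : ∀ P Q → Av P ≐ Av Q → ∃ λ d → Q ≡ setDashes P d
sameWord P Q (P⊆Q , Q⊆P) = redash P Q gaps≡
    (≤-antisym (r-≤ P Q gaps≡ pointwise) (r-≤ Q P (sym gaps≡) λ i<m → sym (pointwise (shorten i<m)))) pointwise
  where
  gaps≡ : gaps P ≡ gaps Q
  gaps≡ = suc-injective (≤-antisym (length-≤ Q P P⊆Q) (length-≤ P Q Q⊆P))
  lengthen : ∀ {a} → a < length P → a < length Q
  lengthen {a} = subst (λ g → a < suc g) gaps≡
  shorten : ∀ {a} → a < length Q → a < length P
  shorten {a} = subst (λ g → a < suc g) (sym gaps≡)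
  pointwise : ∀ {i} → i < length P → wordℕ P i ≡ wordℕ Q i
  pointwise {i} i<m = ≤-antisym
    (word-≤ P Q (λ a<m b<m → order-reflects Q P gaps≡ P⊆Q (lengthen a<m) (lengthen b<m)) _ i<m refl)
    (word-≤ Q P (λ a<m b<m → order-reflects P Q (sym gaps≡) Q⊆P (shorten a<m) (shorten b<m)) _ (lengthen i<m) refl)
  same-letters : ∀ {r g} {w w′ : Vec (Fin r) (suc g)} {d} .{o o′} → w ≡ w′ → mkPattern r g w′ d o′ ≡ mkPattern r g w d o
  same-letters refl = refl
  redash : ∀ P Q → gaps P ≡ gaps Q → r P ≡ r Q → (∀ {i} → i < length P → wordℕ P i ≡ wordℕ Q i) →
    ∃ λ d → Q ≡ setDashes P d
  redash P Q refl refl same = dashes Q , same-letters (letters-determine (word P) (word Q) same)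

-- Adding the missing dashes

closed? : ∀ P → Decidable (Closed P)
closed? P i = nth outside (dashes P) i ≟ᵇ outside

⊆-insert : ∀ {n} (s : Subset n) j → s ⊆ s [ j ]≔ inside
⊆-insert s j {i} i∈s with i FP.≟ j
... | yes refl = VP.[]≔-updates s j
... | no i≢j   = VP.[]≔-minimal s i j i≢j i∈s

insert-⊆ : ∀ {n} {s t : Subset n} {j} → s ⊆ t → j ∈ t → s [ j ]≔ inside ⊆ t
insert-⊆ {s = s} {j = j} s⊆t j∈t {i} i∈ with i FP.≟ j
... | yes refl = j∈t
... | no i≢j   = s⊆t (VP.lookup⇒[]= i s (trans (sym (VP.lookup∘update′ i≢j s inside)) (VP.[]=⇒lookup i∈)))

addDash : ∀ P (d : Subset (gaps P)) → Nontrivial P → Av P ≐ Av (setDashes P d) →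
  ∀ {j} → j ∉ dashes P → j ∈ d → Av P ≐ Av (setGap P j inside)
addDash P@(mkPattern zero _ w _ _) d nontrivial = contradiction (V.head w) λ ()
addDash P@(mkPattern (suc hi) g w e _) d nontrivial (P⊆Q , _) {j} j∉e j∈d = P⊆P′ , P′⊆P
  where
  P′ Q : Pattern
  P′ = setGap P j inside
  Q  = setDashes P d

  0<hi : 0 < hi
  0<hi = n≢0⇒n>0 λ { refl → nontrivial (lookup⁻ λ i → n<1⇒n≡0 (FP.toℕ<n (lookup w i))) }

  P′⊆P : Av P′ ⊆ᵖ Av P
  P′⊆P avoids o = avoids record
    { position = position ; increasing = increasing ; ordered = ordered
    ; adjacent = λ i i∉ → adjacent i (i∉ ∘ ⊆-insert e j) }
    where open Occurrence o

  closed-elsewhere : ∀ {i} → suc i < suc g → Closed P i × i ≢ toℕ j → Closed P′ i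
  closed-elsewhere (s≤s i<g) = ∀<-intro (λ i → Closed P i × i ≢ toℕ j → Closed P′ i)
    (λ i (cl , i≢j) → trans (nth-lookup _ (e [ j ]≔ inside) i)
      (trans (VP.lookup∘update′ (i≢j ∘ cong toℕ) e inside) (trans (sym (nth-lookup _ e i)) cl))) i<g

  dash-at-j : ∀ {i} → suc i < suc g → Closed Q i → i ≢ toℕ j
  dash-at-j _ cl refl = closed⇒∉ Q cl j∈d

  P⊆P′ : Av P ⊆ᵖ Av P′
  P⊆P′ {n , π} avoids o =
    close (closed? P) (s≤s (FP.toℕ<n j)) (∉⇒closed P j∉e) 0<hi
      (s≤s⁻¹ ∘ wordℕ<r P) (wordℕ-onto P z<s) (wordℕ-onto P ≤-refl)
      -- An occurrence with every gap but `j` closed is one of `Q`, as `Q` has a dash at `j`; hence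
      -- it forces one of `P`.
      (λ inj o′ → forced-occurrence _ inj Q P (λ _ → P⊆Q) (weaken dash-at-j o′))
      (values-injective π) (weaken closed-elsewhere (occurrence⇒Occ P′ o)) (avoids ∘ Occ⇒occurrence P)

update-restore : ∀ {a} {A : Set a} {n} (xs : Vec A n) i {x y} → lookup xs i ≡ y → (xs [ i ]≔ x) [ i ]≔ y ≡ xs
update-restore xs i refl = trans (VP.[]≔-idempotent xs i) (VP.[]≔-lookup xs i)

step-sym : ∀ {P Q} → AvPreservingStep P Q → AvPreservingStep Q P
step-sym {P} (inj₁ (j , j∉ , refl) , P≐Q) = inj₂ (j , VP.[]≔-updates (dashes P) j ,
  cong (setDashes P) (sym (update-restore (dashes P) j (∉⇒lookup (dashes P) j∉)))) , swap P≐Q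
step-sym {P} (inj₂ (j , j∈ , refl) , P≐Q) = inj₁ (j ,
  (λ j∈′ → case trans (sym (VP.[]=⇒lookup j∈′)) (VP.lookup∘update j (dashes P) outside) of λ ()) ,
  cong (setDashes P) (sym (update-restore (dashes P) j (VP.[]=⇒lookup j∈)))) , swap P≐Q

-- When `js` lists all gaps, the bounds on `e` make it the union of `dashes P` and `d`. In this form
-- the results from the two ends can be identified by antisymmetry.
absorb : ∀ P (d : Subset (gaps P)) → Nontrivial P → Av P ≐ Av (setDashes P d) → (js : List (Fin (gaps P))) →
  ∃ λ e → Star AvPreservingStep P (setDashes P e) × dashes P ⊆ e × (∀ {j} → j ∈ˡ js → j ∈ d → j ∈ e) ×
    (∀ {s} → dashes P ⊆ s → d ⊆ s → e ⊆ s)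
absorb P d nontrivial P≐Q [] = dashes P , ε , id , (λ ()) , λ P⊆s _ → P⊆s
absorb P d nontrivial P≐Q (j ∷ js) with j SP.∈? dashes P | j SP.∈? d
... | yes j∈P | _ = let e , walk , P⊆e , d⊆e , least = absorb P d nontrivial P≐Q js in
  e , walk , P⊆e , (λ { (here refl) _ → P⊆e j∈P ; (there j∈js) → d⊆e j∈js }) , least
... | no _ | no j∉d = let e , walk , P⊆e , d⊆e , least = absorb P d nontrivial P≐Q js in
  e , walk , P⊆e , (λ { (here refl) j∈d → contradiction j∈d j∉d ; (there j∈js) → d⊆e j∈js }) , least
... | no j∉P | yes j∈d = let
    -- The avoiders are unchanged, so the comparison with `d` stays valid for the enlarged pattern.
    P⊆P′ , P′⊆P = addDash P d nontrivial P≐Q j∉P j∈d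
    e , walk , P′⊆e , d⊆e , least = absorb (setGap P j inside) d nontrivial
      (proj₁ P≐Q ∘ P′⊆P , P⊆P′ ∘ proj₂ P≐Q) js in
  e , (inj₁ (j , j∉P , refl) , P⊆P′ , P′⊆P) ◅ walk , P′⊆e ∘ ⊆-insert (dashes P) j ,
  (λ { (here refl) _ → P′⊆e (VP.[]≔-updates (dashes P) j) ; (there j∈js) → d⊆e j∈js }) ,
  λ P⊆s d⊆s → least (insert-⊆ P⊆s (d⊆s j∈d)) d⊆s

redash-steps : ∀ P d → Nontrivial P → Nontrivial (setDashes P d) → Av P ≐ Av (setDashes P d) →
  Star AvPreservingStep P (setDashes P d)
redash-steps P d P-nontrivial Q-nontrivial P≐Q =
  let e  , P⇒e  , P⊆e  , d⊆e  , e-least  = absorb P d P-nontrivial P≐Q (allFin (gaps P))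
      e′ , Q⇒e′ , d⊆e′ , P⊆e′ , e′-least =
        absorb (setDashes P d) (dashes P) Q-nontrivial (swap P≐Q) (allFin (gaps P))
      e≡e′ = SP.⊆-antisym (e-least (P⊆e′ (∈-allFin _)) d⊆e′) (e′-least (d⊆e (∈-allFin _)) P⊆e)
  -- Steps are symmetric: the walk from the second pattern up to the union is traversed backwards,
  -- removing dashes.
  in P⇒e ◅◅ subst (λ s → Star AvPreservingStep (setDashes P s) (setDashes P d)) (sym e≡e′) (reverse step-sym Q⇒e′)

proposition2 : (P Q : Pattern) → Nontrivial P → Nontrivial Q → Av P ≐ Av Q →
    Star AvPreservingStep P Q
proposition2 P Q P-nontrivial Q-nontrivial P≐Q = let d , Q≡ = sameWord P Q P≐Q in
  subst (Star AvPreservingStep P) (sym Q≡)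
    (redash-steps P d P-nontrivial (subst Nontrivial Q≡ Q-nontrivial) (subst (λ R → Av P ≐ Av R) Q≡ P≐Q))
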